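{- The semidefinite program $\mathrm{SDP}_A$ (Anstreicher's QAP relaxation specialized to the traveling salesman problem, defined in the context) has an unbounded integrality gap; that is, $$\sup_{D\in\mathcal{D}} \frac{\mathrm{OPT}_{\mathrm{TSP}}(D)}{\mathrm{OPT}_{\mathrm{SDP}_A}(D)}=+\infty .$$
   Context: TSP: an instance on $n$ vertices is a symmetric matrix $D=(d_{ij})\in\mathbb{R}^{n\times n}$ with $d_{ij}\ge 0$, $d_{ii}=0$ and $d_{ij}\le d_{ik}+d_{kj}$ for all $i,j,k$ (distinct vertices may be at distance $0$). $\mathcal{D}$ is the set of all such matrices, over all $n\ge 3$. $\mathrm{OPT}_{\mathrm{TSP}}(D)$ is the minimum total cost of a Hamiltonian cycle in $K_n$ with edge costs $d_{ij}$. Notation: $I_m$, $J_m$ are the $m\times m$ identity and all-ones matrices; $e^{(n)}\in\mathbb{R}^n$ is the all-ones vector; $\mathbb{S}^{m\times m}$ is the set of real symmetric $m\times m$ matrices; $\otimes$ is the Kronecker product; $\ge 0$ for matrices is entrywise and $\succeq 0$ means positive semidefinite. $C^{(n)}_1$ is the adjacency matrix of the $n$-cycle with edges $\{i,i+1\}$ and $\{n,1\}$. $\mathrm{SDP}_A$: partition $Y\in\mathbb{S}^{n^2\times n^2}$ into $n\times n$ blocks $Y^{(ij)}$, $1\le i,j\le n$. Let $$F=\begin{pmatrix}(e^{(n)})^T\otimes I_n\\ I_n\otimes (e^{(n)})^T\end{pmatrix}.$$ $\mathrm{OPT}_{\mathrm{SDP}_A}(D)$ is the minimum of $\tfrac12\mathrm{trace}\big((D\otimes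 C^{(n)}_1)Y\big)$ over $Y\in\mathbb{S}^{n^2\times n^2}$ with $Y\ge 0$ and (i) $\sum_{i=1}^n Y^{(ii)}=I_n$; (ii) $\big(\mathrm{trace}(Y^{(ij)})\big)_{i,j=1}^n=I_n$; (iii) $\mathrm{trace}(YF^TF)=2n$; (iv) $Y-\frac{1}{n^2}J_{n^2}\succeq 0$. In the supremum, instances with $\mathrm{OPT}_{\mathrm{TSP}}(D)=0$ are disregarded, and a ratio with positive numerator and zero denominator is read as $+\infty$. -}

module Defs where

open import Algebra.Bundles.Raw using (RawMonoid)
open import Data.Bool.Base using (if_then_else_; _∨_)
open import Data.Fin.Base using (Fin; combine; quotient; remainder; splitAt; toℕ)
open import Data.Fin.Permutation using (Permutation′; _⟨$⟩ʳ_)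
open import Data.Fin.Properties using (_≟_)
open import Data.Integer.Base using (+_)
open import Data.Nat.Base as ℕ using (ℕ; suc)
open import Data.Nat.DivMod using (_mod_)
import Data.Nat.Properties as ℕ
open import Data.Product.Base using (∃; _×_; _,_)
open import Data.Rational.Base as ℚ using (ℚ; 0ℚ; 1ℚ; ½)
import Data.Rational.Properties as ℚ
open import Data.Rational.Solver using (module +-*-Solver)
open import Data.Sum.Base using ([_,_]′)
open import Relation.Binary.PropositionalEquality
  using (_≡_; refl; sym; trans; cong; cong₂; subst)
open import Relation.Nullary.Decidable.Core using (does)
open import Relation.Unary using (Pred)

------------------------------------------------------------------------
-- Real numbers: Cauchy sequences of rationals, with the setoid equality
-- _≈_ ("the difference tends to zero").

IsCauchy : (ℕ → ℚ) → Set
IsCauchy x = ∀ ε → 0ℚ ℚ.< ε →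
  ∃ λ N → ∀ {m n} → N ℕ.≤ m → N ℕ.≤ n → ℚ.∣ x m ℚ.- x n ∣ ℚ.< ε

record ℝ : Set where
  constructor mkℝ
  field
    seq    : ℕ → ℚ
    cauchy : IsCauchy seq

open ℝ public

infix 4 _≈_ _≤_ _<_

record _≈_ (x y : ℝ) : Set where
  constructor mk≈
  field
    eventually-close : ∀ ε → 0ℚ ℚ.< ε →
      ∃ λ N → ∀ {n} → N ℕ.≤ n → ℚ.∣ seq x n ℚ.- seq y n ∣ ℚ.< ε

record _≤_ (x y : ℝ) : Set where
  constructor mk≤
  field
    eventually-below : ∀ ε → 0ℚ ℚ.< ε →
      ∃ λ N → ∀ {n} → N ℕ.≤ n → seq x n ℚ.< seq y n ℚ.+ ε

-- A uniform rational gap is required: eventual strict inequality of the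
-- terms would not respect _≈_.
record _<_ (x y : ℝ) : Set where
  constructor mk<
  field
    gap              : ℚ
    gap-positive     : 0ℚ ℚ.< gap
    start            : ℕ
    eventually-apart : ∀ {n} → start ℕ.≤ n → seq x n ℚ.+ gap ℚ.< seq y n

private
  abstract
    halve : ∀ ε → 0ℚ ℚ.< ε → 0ℚ ℚ.< ½ ℚ.* ε
    halve ε 0<ε = subst (ℚ._< ½ ℚ.* ε) (ℚ.*-zeroʳ ½) (ℚ.*-monoʳ-<-pos ½ 0<ε)

    halves : ∀ ε → ½ ℚ.* ε ℚ.+ ½ ℚ.* ε ≡ ε
    halves ε = trans (sym (ℚ.*-distribʳ-+ ε ½ ½)) (ℚ.*-identityˡ ε)

    const-cauchy : ∀ q → IsCauchy (λ _ → q)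
    const-cauchy q ε 0<ε = 0 , λ _ _ →
      subst (ℚ._< ε) (sym (cong ℚ.∣_∣ (ℚ.+-inverseʳ q))) 0<ε

    +-cauchy : ∀ {x y} → IsCauchy x → IsCauchy y → IsCauchy (λ n → x n ℚ.+ y n)
    +-cauchy {x} {y} cx cy ε 0<ε with cx _ (halve ε 0<ε) | cy _ (halve ε 0<ε)
    ... | N , p | K , q = N ℕ.⊔ K , λ {m} {n} N≤m N≤n → begin-strict
      ℚ.∣ (x m ℚ.+ y m) ℚ.- (x n ℚ.+ y n) ∣
        ≡⟨ cong ℚ.∣_∣ (rearrange (x m) (y m) (x n) (y n)) ⟩
      ℚ.∣ (x m ℚ.- x n) ℚ.+ (y m ℚ.- y n) ∣
        ≤⟨ ℚ.∣p+q∣≤∣p∣+∣q∣ (x m ℚ.- x n) (y m ℚ.- y n) ⟩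
      ℚ.∣ x m ℚ.- x n ∣ ℚ.+ ℚ.∣ y m ℚ.- y n ∣
        <⟨ ℚ.+-mono-< (p (ℕ.m⊔n≤o⇒m≤o N K N≤m) (ℕ.m⊔n≤o⇒m≤o N K N≤n))
                      (q (ℕ.m⊔n≤o⇒n≤o N K N≤m) (ℕ.m⊔n≤o⇒n≤o N K N≤n)) ⟩
      ½ ℚ.* ε ℚ.+ ½ ℚ.* ε
        ≡⟨ halves ε ⟩
      ε ∎
      where
      open ℚ.≤-Reasoning
      open +-*-Solver
      rearrange : ∀ a b c d →
        (a ℚ.+ b) ℚ.- (c ℚ.+ d) ≡ (a ℚ.- c) ℚ.+ (b ℚ.- d)
      rearrange = solve 4 (λ a b c d →
        (a :+ b) :- (c :+ d) := (a :- c) :+ (b :- d)) refl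

    neg-cauchy : ∀ {x} → IsCauchy x → IsCauchy (λ n → ℚ.- x n)
    neg-cauchy {x} cx ε 0<ε with cx ε 0<ε
    ... | N , p = N , λ {m} {n} N≤m N≤n →
      subst (ℚ._< ε) (cong ℚ.∣_∣ (flip (x n) (x m))) (p N≤n N≤m)
      where
      open +-*-Solver
      flip : ∀ a b → a ℚ.- b ≡ (ℚ.- b) ℚ.- (ℚ.- a)
      flip = solve 2 (λ a b → a :- b := (:- b) :- (:- a)) refl

    eventually-bounded : ∀ {x} → IsCauchy x →
      ∃ λ B → 0ℚ ℚ.< B × ∃ λ N → ∀ {n} → N ℕ.≤ n → ℚ.∣ x n ∣ ℚ.≤ B
    eventually-bounded {x} cx with cx 1ℚ (ℚ.positive⁻¹ 1ℚ)
    ... | N , p = B , 0<B , N , bound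
      where
      open ℚ.≤-Reasoning
      open +-*-Solver
      B : ℚ
      B = 1ℚ ℚ.+ ℚ.∣ x N ∣
      0<B : 0ℚ ℚ.< B
      0<B = ℚ.+-mono-<-≤ (ℚ.positive⁻¹ 1ℚ) (ℚ.0≤∣p∣ (x N))
      split : ∀ a b → a ≡ (a ℚ.- b) ℚ.+ b
      split = solve 2 (λ a b → a := (a :- b) :+ b) refl
      bound : ∀ {n} → N ℕ.≤ n → ℚ.∣ x n ∣ ℚ.≤ B
      bound {n} N≤n = begin
        ℚ.∣ x n ∣                             ≡⟨ cong ℚ.∣_∣ (split (x n) (x N)) ⟩
        ℚ.∣ (x n ℚ.- x N) ℚ.+ x N ∣           ≤⟨ ℚ.∣p+q∣≤∣p∣+∣q∣ (x n ℚ.- x N) (x N) ⟩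
        ℚ.∣ x n ℚ.- x N ∣ ℚ.+ ℚ.∣ x N ∣       ≤⟨ ℚ.+-monoˡ-≤ ℚ.∣ x N ∣ (ℚ.<⇒≤ (p N≤n ℕ.≤-refl)) ⟩
        B                                     ∎

    quotient-bound : ∀ B → 0ℚ ℚ.< B → ∀ ε → 0ℚ ℚ.< ε →
      ∃ λ δ → 0ℚ ℚ.< δ × B ℚ.* δ ≡ ε
    quotient-bound B 0<B ε 0<ε = B⁻¹ ℚ.* ε , 0<δ , cancel
      where
      instance
        B-pos : ℚ.Positive B
        B-pos = ℚ.positive 0<B
        B-nonZero : ℚ.NonZero B
        B-nonZero = ℚ.pos⇒nonZero B
      B⁻¹ : ℚ
      B⁻¹ = ℚ.1/ B
      instance
        B⁻¹-pos : ℚ.Positive B⁻¹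
        B⁻¹-pos = ℚ.1/pos⇒pos B
      0<δ : 0ℚ ℚ.< B⁻¹ ℚ.* ε
      0<δ = subst (ℚ._< B⁻¹ ℚ.* ε) (ℚ.*-zeroʳ B⁻¹) (ℚ.*-monoʳ-<-pos B⁻¹ 0<ε)
      cancel : B ℚ.* (B⁻¹ ℚ.* ε) ≡ ε
      cancel = trans (sym (ℚ.*-assoc B B⁻¹ ε))
        (trans (cong (ℚ._* ε) (ℚ.*-inverseʳ B)) (ℚ.*-identityˡ ε))

    product-bound : ∀ {a b B δ} → 0ℚ ℚ.< B →
      ℚ.∣ a ∣ ℚ.≤ B → ℚ.∣ b ∣ ℚ.< δ → ℚ.∣ a ℚ.* b ∣ ℚ.< B ℚ.* δ
    product-bound {a} {b} {B} {δ} 0<B ∣a∣≤B ∣b∣<δ = begin-strict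
      ℚ.∣ a ℚ.* b ∣         ≡⟨ ℚ.∣p*q∣≡∣p∣*∣q∣ a b ⟩
      ℚ.∣ a ∣ ℚ.* ℚ.∣ b ∣   ≤⟨ ℚ.*-monoʳ-≤-nonNeg ℚ.∣ b ∣ {{ℚ.∣-∣-nonNeg b}} ∣a∣≤B ⟩
      B ℚ.* ℚ.∣ b ∣         <⟨ ℚ.*-monoʳ-<-pos B {{ℚ.positive 0<B}} ∣b∣<δ ⟩
      B ℚ.* δ               ∎
      where open ℚ.≤-Reasoning

    product-difference : ∀ {a b c d A B α β ε} → 0ℚ ℚ.< A → 0ℚ ℚ.< B →
      A ℚ.* α ≡ ½ ℚ.* ε → B ℚ.* β ≡ ½ ℚ.* ε →
      ℚ.∣ a ∣ ℚ.≤ A → ℚ.∣ d ∣ ℚ.≤ B →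
      ℚ.∣ b ℚ.- d ∣ ℚ.< α → ℚ.∣ a ℚ.- c ∣ ℚ.< β →
      ℚ.∣ a ℚ.* b ℚ.- c ℚ.* d ∣ ℚ.< ε
    product-difference {a} {b} {c} {d} {A} {B} {α} {β} {ε} 0<A 0<B Aα≡ Bβ≡ a≤A d≤B b-d<α a-c<β =
      begin-strict
      ℚ.∣ a ℚ.* b ℚ.- c ℚ.* d ∣
        ≡⟨ cong ℚ.∣_∣ (rearrange a b c d) ⟩
      ℚ.∣ a ℚ.* (b ℚ.- d) ℚ.+ d ℚ.* (a ℚ.- c) ∣
        ≤⟨ ℚ.∣p+q∣≤∣p∣+∣q∣ (a ℚ.* (b ℚ.- d)) (d ℚ.* (a ℚ.- c)) ⟩
      ℚ.∣ a ℚ.* (b ℚ.- d) ∣ ℚ.+ ℚ.∣ d ℚ.* (a ℚ.- c) ∣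
        <⟨ ℚ.+-mono-< (product-bound {a} {b ℚ.- d} 0<A a≤A b-d<α)
                      (product-bound {d} {a ℚ.- c} 0<B d≤B a-c<β) ⟩
      A ℚ.* α ℚ.+ B ℚ.* β
        ≡⟨ cong₂ ℚ._+_ Aα≡ Bβ≡ ⟩
      ½ ℚ.* ε ℚ.+ ½ ℚ.* ε
        ≡⟨ halves ε ⟩
      ε ∎
      where
      open ℚ.≤-Reasoning
      open +-*-Solver
      rearrange : ∀ a b c d →
        a ℚ.* b ℚ.- c ℚ.* d ≡ a ℚ.* (b ℚ.- d) ℚ.+ d ℚ.* (a ℚ.- c)
      rearrange = solve 4 (λ a b c d →
        a :* b :- c :* d := a :* (b :- d) :+ d :* (a :- c)) refl

    *-cauchy : ∀ {x y} → IsCauchy x → IsCauchy y → IsCauchy (λ n → x n ℚ.* y n)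
    *-cauchy {x} {y} cx cy ε 0<ε =
      let A , 0<A , N₁ , x≤A = eventually-bounded cx
          B , 0<B , N₂ , y≤B = eventually-bounded cy
          α , 0<α , Aα≡      = quotient-bound A 0<A (½ ℚ.* ε) (halve ε 0<ε)
          β , 0<β , Bβ≡      = quotient-bound B 0<B (½ ℚ.* ε) (halve ε 0<ε)
          N₃ , p             = cy α 0<α
          N₄ , q             = cx β 0<β
          L = N₁ ℕ.⊔ N₂
          R = N₃ ℕ.⊔ N₄
      in L ℕ.⊔ R , λ {m} {n} N≤m N≤n →
        let L≤m = ℕ.m⊔n≤o⇒m≤o L R N≤m
            R≤m = ℕ.m⊔n≤o⇒n≤o L R N≤m
            L≤n = ℕ.m⊔n≤o⇒m≤o L R N≤n
            R≤n = ℕ.m⊔n≤o⇒n≤o L R N≤n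
        in product-difference {x m} {y m} {x n} {y n} 0<A 0<B Aα≡ Bβ≡
             (x≤A (ℕ.m⊔n≤o⇒m≤o N₁ N₂ L≤m))
             (y≤B (ℕ.m⊔n≤o⇒n≤o N₁ N₂ L≤n))
             (p (ℕ.m⊔n≤o⇒m≤o N₃ N₄ R≤m) (ℕ.m⊔n≤o⇒m≤o N₃ N₄ R≤n))
             (q (ℕ.m⊔n≤o⇒n≤o N₃ N₄ R≤m) (ℕ.m⊔n≤o⇒n≤o N₃ N₄ R≤n))

infixl 6 _+_ _-_
infixl 7 _*_
infix  8 -_

fromℚ : ℚ → ℝ
fromℚ q = mkℝ (λ _ → q) (const-cauchy q)

0ℝ 1ℝ : ℝ
0ℝ = fromℚ 0ℚ
1ℝ = fromℚ 1ℚ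

fromℕ : ℕ → ℝ
fromℕ n = fromℚ (+ n ℚ./ 1)

_+_ : ℝ → ℝ → ℝ
x + y = mkℝ (λ n → seq x n ℚ.+ seq y n) (+-cauchy {seq x} {seq y} (cauchy x) (cauchy y))

-_ : ℝ → ℝ
- x = mkℝ (λ n → ℚ.- seq x n) (neg-cauchy {seq x} (cauchy x))

_-_ : ℝ → ℝ → ℝ
x - y = x + (- y)

_*_ : ℝ → ℝ → ℝ
x * y = mkℝ (λ n → seq x n ℚ.* seq y n) (*-cauchy {seq x} {seq y} (cauchy x) (cauchy y))

+-0-rawMonoid : RawMonoid _ _
+-0-rawMonoid = record { Carrier = ℝ ; _≈_ = _≈_ ; _∙_ = _+_ ; ε = 0ℝ }

open import Algebra.Definitions.RawMonoid +-0-rawMonoid public using (sum)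

IsLeast : Pred ℝ _ → ℝ → Set
IsLeast P v = P v × (∀ w → P w → v ≤ w)

------------------------------------------------------------------------
-- Matrices

Matrix : ℕ → ℕ → Set
Matrix m n = Fin m → Fin n → ℝ

infix  4 _≈ᴹ_
infixl 6 _-ᴹ_
infixl 7 _·_ _⊗_ _•_
infix  9 _ᵀ

_≈ᴹ_ : ∀ {m n} → Matrix m n → Matrix m n → Set
A ≈ᴹ B = ∀ i j → A i j ≈ B i j

_-ᴹ_ : ∀ {m n} → Matrix m n → Matrix m n → Matrix m n
(A -ᴹ B) i j = A i j - B i j

_•_ : ∀ {m n} → ℝ → Matrix m n → Matrix m n
(c • A) i j = c * A i j

_·_ : ∀ {l m n} → Matrix l m → Matrix m n → Matrix l n
(A · B) i j = sum λ k → A i k * B k j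

_ᵀ : ∀ {m n} → Matrix m n → Matrix n m
(A ᵀ) i j = A j i

trace : ∀ {n} → Matrix n n → ℝ
trace A = sum λ i → A i i

_⊗_ : ∀ {m n p q} → Matrix m n → Matrix p q → Matrix (m ℕ.* p) (n ℕ.* q)
_⊗_ {m} {n} {p} {q} A B i j =
  A (quotient {m} p i) (quotient {n} q j) * B (remainder {m} p i) (remainder {n} q j)

stack : ∀ {m p n} → Matrix m n → Matrix p n → Matrix (m ℕ.+ p) n
stack {m} A B i = [ A , B ]′ (splitAt m i)

I : ∀ n → Matrix n n
I n i j = if does (i ≟ j) then 1ℝ else 0ℝ

J : ∀ n → Matrix n n
J n i j = 1ℝ

onesRow : ∀ n → Matrix 1 n
onesRow n i j = 1ℝ

Symmetric : ∀ {n} → Matrix n n → Set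
Symmetric A = A ᵀ ≈ᴹ A

NonNegative : ∀ {m n} → Matrix m n → Set
NonNegative A = ∀ i j → 0ℝ ≤ A i j

PSD : ∀ {n} → Matrix n n → Set
PSD {n} A = Symmetric A ×
  (∀ (x : Fin n → ℝ) → 0ℝ ≤ sum λ i → sum λ j → x i * A i j * x j)

------------------------------------------------------------------------
-- The traveling salesman problem

next : ∀ {n} .{{_ : ℕ.NonZero n}} → Fin n → Fin n
next {n} i = suc (toℕ i) mod n

record TSPInstance : Set where
  field
    n         : ℕ
    3≤n       : 3 ℕ.≤ n
    D         : Matrix n n
    symmetric : Symmetric D
    nonneg    : NonNegative D
    diagonal  : ∀ i → D i i ≈ 0ℝ
    triangle  : ∀ i j k → D i j ≤ D i k + D k j

  instance
    n≢0 : ℕ.NonZero n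
    n≢0 = ℕ.>-nonZero (ℕ.≤-trans (ℕ.s≤s ℕ.z≤n) 3≤n)

-- A Hamiltonian cycle of Kₙ is given by the order σ 0, σ 1, …, σ (n-1)
-- in which it visits the vertices.
tourCost : ∀ {n} .{{_ : ℕ.NonZero n}} → Matrix n n → Permutation′ n → ℝ
tourCost D σ = sum λ k → D (σ ⟨$⟩ʳ k) (σ ⟨$⟩ʳ next k)

TourValue : ∀ {n} .{{_ : ℕ.NonZero n}} → Matrix n n → Pred ℝ _
TourValue D v = ∃ λ σ → v ≈ tourCost D σ

IsOPT-TSP : ∀ {n} .{{_ : ℕ.NonZero n}} → Matrix n n → ℝ → Set
IsOPT-TSP D = IsLeast (TourValue D)

------------------------------------------------------------------------
-- The semidefinite program

C₁ : ∀ n .{{_ : ℕ.NonZero n}} → Matrix n n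
C₁ n i j = if does (next i ≟ j) ∨ does (next j ≟ i) then 1ℝ else 0ℝ

F : ∀ n → Matrix (1 ℕ.* n ℕ.+ n ℕ.* 1) (n ℕ.* n)
F n = stack (onesRow n ⊗ I n) (I n ⊗ onesRow n)

block : ∀ {n} → Matrix (n ℕ.* n) (n ℕ.* n) → Fin n → Fin n → Matrix n n
block Y i j k l = Y (combine i k) (combine j l)

1/n² : ∀ n .{{_ : ℕ.NonZero n}} → ℝ
1/n² n = fromℚ (ℚ._/_ (+ 1) (n ℕ.* n) {{ℕ.m*n≢0 n n}})

record Feasible n .{{_ : ℕ.NonZero n}} (Y : Matrix (n ℕ.* n) (n ℕ.* n)) : Set where
  field
    symmetric      : Symmetric Y
    nonneg         : NonNegative Y
    diagonalBlocks : (λ k l → sum λ i → block Y i i k l) ≈ᴹ I n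
    blockTraces    : (λ i j → trace (block Y i j)) ≈ᴹ I n
    traceYFᵀF      : trace (Y · (F n ᵀ · F n)) ≈ fromℕ (2 ℕ.* n)
    psd            : PSD (Y -ᴹ 1/n² n • J (n ℕ.* n))

objective : ∀ {n} .{{_ : ℕ.NonZero n}} →
  Matrix n n → Matrix (n ℕ.* n) (n ℕ.* n) → ℝ
objective {n} D Y = fromℚ ½ * trace ((D ⊗ C₁ n) · Y)

SDPValue : ∀ {n} .{{_ : ℕ.NonZero n}} → Matrix n n → Pred ℝ _
SDPValue {n} D v = ∃ λ Y → Feasible n Y × v ≈ objective D Y

IsOPT-SDP : ∀ {n} .{{_ : ℕ.NonZero n}} → Matrix n n → ℝ → Set
IsOPT-SDP D = IsLeast (SDPValue D)

-- Take n = 2m cities in two clusters, at distance 0 within a cluster and 1 across; an optimal tour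
-- costs 2. Place the n positions at rational points u k of the unit circle with u (k + m) = - u k,
-- in steps of length O(1/m), and put Q k l = (1 + ⟨u k, u l⟩)/2. In the same way the clusters give
-- E i j = (1 + s i s j)/2 with signs s i. Both matrices have unit diagonal, entries in [0, 1] and row
-- sums m, so that m I - E and m I - Q are weighted graph Laplacians. The matrix Y built
-- from E and Q below satisfies
--   n (Y - J/n²) = (2E - J) ⊗ (2Q - J) / n + (m I - E) ⊗ (m I - Q) / (m (m - 1)),
-- a sum of Kronecker products of sums of squares, hence it is feasible. Its value is a sum of n terms
-- of size 1 - Q k (k + 1) = O(1/m²), thus O(1/m). Since Y is rational, all real inequalities are
-- checked termwise along the Cauchy sequences.

module Submission where

open import Algebra.Bundles using (CommutativeRing)
open import Data.Bool.Base using (if_then_else_; _∨_; true; false)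
open import Data.Fin.Base
  using (Fin; zero; suc; toℕ; combine; quotient; remainder; splitAt; _↑ˡ_; _↑ʳ_)
import Data.Fin.Permutation as Perm
open import Data.Fin.Permutation using (Permutation′; _⟨$⟩ʳ_; _⟨$⟩ˡ_; inverseʳ)
open import Data.Fin.Properties
  using (_≟_; remQuot-combine; splitAt-↑ˡ; splitAt-↑ʳ; toℕ-↑ˡ; toℕ-↑ʳ; toℕ<n; toℕ-fromℕ<; toℕ-injective)
open import Data.Nat.Base as ℕ using (ℕ; zero; suc)
open import Data.Nat.Coprimality using (1-coprimeTo) renaming (sym to coprime-sym)
open import Data.Nat.DivMod using (_%_; _mod_; m<n⇒m%n≡m; m%n<n; n%n≡0)
import Data.Nat.Properties as ℕ
open import Data.Product.Base using (∃; _×_; _,_; proj₁; proj₂)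
open import Data.Rational.Base as ℚ using (ℚ; 0ℚ; 1ℚ; ½)
import Data.Rational.Properties as ℚ
open import Data.Rational.Solver using (module +-*-Solver)
import Data.Rational.Unnormalised.Base as ℚᵘ
import Data.Rational.Unnormalised.Properties as ℚᵘ
open import Data.Sum.Base using (_⊎_; inj₁; inj₂; [_,_]′)
open import Data.Unit.Base using (tt)
open import Function.Base using (_∘_)
open import Relation.Binary.PropositionalEquality
  using (_≡_; refl; sym; trans; cong; cong₂; subst; subst₂; module ≡-Reasoning)
open import Relation.Nullary.Decidable using (from-yes)
open import Relation.Nullary.Decidable.Core using (does; yes; no)
open import Relation.Nullary.Negation.Core using (contradiction)

open import Algebra.Properties.Semiring.Sum (CommutativeRing.semiring ℚ.+-*-commutativeRing)
  using (sum-cong-≗; ∑-distrib-+; ∑-comm; *-distribˡ-sum; *-distribʳ-sum)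
  renaming (sum to ∑)

open import Defs using (next)

-- Along a tour the cluster of the city in position k is a sign, and the signs change at least twice
-- round the cycle, at cost 1 each time. In Y the products of two such signs are replaced by inner
-- products of unit vectors with sum zero, and vectors can turn gradually. Summed over all pairs of
-- cities in different clusters, the entries of Y at positions k and l add up to 1 - Q k l, which
-- thus acts as the probability that these positions hold different clusters. It is quadratic in the
-- step length, so turning once round the circle in 2m small steps is far cheaper than two jumps.
-- The obstacle is the diagonal: the conditions on diagonal blocks and block traces force all mass
-- with i = j onto k = l and conversely. So I is removed from E and Q; Q - I has row sums m - 1, and
-- the same-cluster part is divided by m - 1 instead of m. The excess 1/(m - 1) - 1/m = 1/(m (m -
-- 1)) is exactly the coefficient of the product of Laplacians. The condition on F^T F needs no
-- further construction: it adds up the block traces and the entries of the diagonal blocks.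

module _ where
  open import Data.Rational.Base
  open +-*-Solver

  -- Rational inequalities and finite sums.

  *-nonneg : ∀ {p q} → 0ℚ ≤ p → 0ℚ ≤ q → 0ℚ ≤ p * q
  *-nonneg {p} {q} 0≤p 0≤q =
    subst (_≤ p * q) (ℚ.*-zeroʳ p) (ℚ.*-monoˡ-≤-nonNeg p {{nonNegative 0≤p}} 0≤q)

  square-nonneg : ∀ p → 0ℚ ≤ p * p
  square-nonneg p with ℚ.≤-total 0ℚ p
  ... | inj₁ 0≤p = *-nonneg 0≤p 0≤p
  ... | inj₂ p≤0 = subst (0ℚ ≤_) (solve 1 (λ p → (:- p) :* (:- p) := p :* p) refl p)
                     (*-nonneg (ℚ.neg-antimono-≤ p≤0) (ℚ.neg-antimono-≤ p≤0))

  +-nonneg : ∀ {p q} → 0ℚ ≤ p → 0ℚ ≤ q → 0ℚ ≤ p + q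
  +-nonneg = ℚ.+-mono-≤

  p≤q⇒0≤q-p : ∀ {p q} → p ≤ q → 0ℚ ≤ q - p
  p≤q⇒0≤q-p {p} {q} p≤q = subst (_≤ q - p) (ℚ.+-inverseʳ p) (ℚ.+-monoˡ-≤ (- p) p≤q)

  0≤q-p⇒p≤q : ∀ {p q} → 0ℚ ≤ q - p → p ≤ q
  0≤q-p⇒p≤q {p} {q} 0≤q-p =
    subst₂ _≤_ (ℚ.+-identityˡ p) (solve 2 (λ p q → q :- p :+ p := q) refl p q) (ℚ.+-monoˡ-≤ p 0≤q-p)

  ∑-mono : ∀ {n} {f g : Fin n → ℚ} → (∀ i → f i ≤ g i) → ∑ f ≤ ∑ g
  ∑-mono {zero}  f≤g = ℚ.≤-refl
  ∑-mono {suc n} f≤g = ℚ.+-mono-≤ (f≤g zero) (∑-mono (f≤g ∘ suc))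

  ∑-zero : ∀ n → ∑ {n} (λ _ → 0ℚ) ≡ 0ℚ
  ∑-zero zero    = refl
  ∑-zero (suc n) = trans (ℚ.+-identityˡ _) (∑-zero n)

  ∑-nonneg : ∀ {n} {f : Fin n → ℚ} → (∀ i → 0ℚ ≤ f i) → 0ℚ ≤ ∑ f
  ∑-nonneg {n} {f} 0≤f = subst (_≤ ∑ f) (∑-zero n) (∑-mono 0≤f)

  ∑²-cong : ∀ {m n} {f g : Fin m → Fin n → ℚ} → (∀ i j → f i j ≡ g i j) →
    (∑ λ i → ∑ λ j → f i j) ≡ ∑ λ i → ∑ λ j → g i j
  ∑²-cong f≡g = sum-cong-≗ λ i → sum-cong-≗ (f≡g i)

  ∑²-distrib-+ : ∀ {m n} (f g : Fin m → Fin n → ℚ) →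
    (∑ λ i → ∑ λ j → f i j + g i j) ≡ (∑ λ i → ∑ λ j → f i j) + ∑ λ i → ∑ λ j → g i j
  ∑²-distrib-+ f g = trans (sum-cong-≗ λ i → ∑-distrib-+ (f i) (g i))
                           (∑-distrib-+ (λ i → ∑ (f i)) (λ i → ∑ (g i)))

  *-distribˡ-∑² : ∀ {m n} c (f : Fin m → Fin n → ℚ) →
    c * (∑ λ i → ∑ λ j → f i j) ≡ ∑ λ i → ∑ λ j → c * f i j
  *-distribˡ-∑² c f = trans (*-distribˡ-sum c (λ i → ∑ (f i))) (sum-cong-≗ λ i → *-distribˡ-sum c (f i))

  ∑*∑ : ∀ {m n} (f : Fin m → ℚ) (g : Fin n → ℚ) → ∑ f * ∑ g ≡ ∑ λ i → ∑ λ j → f i * g j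
  ∑*∑ f g = trans (*-distribʳ-sum (∑ g) f) (sum-cong-≗ λ i → *-distribˡ-sum (f i) g)

  ∑-alternating : ∀ {n} (f g h k : Fin n → ℚ) →
    (∑ λ i → f i - g i - h i + k i) ≡ ∑ f - ∑ g - ∑ h + ∑ k
  ∑-alternating {zero}  f g h k = refl
  ∑-alternating {suc n} f g h k = trans (cong (f zero - g zero - h zero + k zero +_)
    (∑-alternating (f ∘ suc) (g ∘ suc) (h ∘ suc) (k ∘ suc)))
    (solve 8 (λ a b c d a' b' c' d' →
      (a :- b :- c :+ d) :+ (a' :- b' :- c' :+ d') := (a :+ a') :- (b :+ b') :- (c :+ c') :+ (d :+ d'))
      refl (f zero) (g zero) (h zero) (k zero) (∑ (f ∘ suc)) (∑ (g ∘ suc)) (∑ (h ∘ suc)) (∑ (k ∘ suc)))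

  ∑-↑ : ∀ m {n} (f : Fin (m ℕ.+ n) → ℚ) → ∑ f ≡ ∑ (λ i → f (i ↑ˡ n)) + ∑ (λ j → f (m ↑ʳ j))
  ∑-↑ zero    f = sym (ℚ.+-identityˡ _)
  ∑-↑ (suc m) f = trans (cong (f zero +_) (∑-↑ m (f ∘ suc))) (sym (ℚ.+-assoc (f zero) _ _))

  ∑-combine : ∀ m {n} (f : Fin (m ℕ.* n) → ℚ) → ∑ f ≡ ∑ λ i → ∑ λ k → f (combine {m} {n} i k)
  ∑-combine zero        f = refl
  ∑-combine (suc m) {n} f = trans (∑-↑ n f) (cong (∑ (λ k → f (k ↑ˡ m ℕ.* n)) +_) (∑-combine m (λ j → f (n ↑ʳ j))))

  -- The number n as a rational, written as a sum so that counting arguments stay within the laws of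
  -- `∑`; `ones≡/1` links it to the quotient form.
  ones : ℕ → ℚ
  ones n = ∑ {n} (λ _ → 1ℚ)

  ∑-const : ∀ n q → ∑ {n} (λ _ → q) ≡ ones n * q
  ∑-const n q = trans (sum-cong-≗ {n} λ _ → sym (ℚ.*-identityˡ q)) (sym (*-distribʳ-sum {n} q (λ _ → 1ℚ)))

  ones-+ : ∀ m n → ones (m ℕ.+ n) ≡ ones m + ones n
  ones-+ m n = ∑-↑ m {n} (λ _ → 1ℚ)

  ones-* : ∀ m n → ones (m ℕ.* n) ≡ ones m * ones n
  ones-* m n = trans (∑-combine m {n} (λ _ → 1ℚ)) (∑-const m (ones n))

  -- Sums of squares

  Mat : ℕ → Set
  Mat n = Fin n → Fin n → ℚ

  δ : ∀ {n} → Mat n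
  δ i j = if does (i ≟ j) then 1ℚ else 0ℚ

  ∑-δ : ∀ {n} i (f : Fin n → ℚ) → (∑ λ a → δ a i * f a) ≡ f i
  ∑-δ {suc n} zero f = trans
    (cong₂ _+_ (ℚ.*-identityˡ (f zero))
      (trans (sum-cong-≗ λ a → ℚ.*-zeroˡ (f (suc a))) (∑-zero n)))
    (ℚ.+-identityʳ (f zero))
  ∑-δ (suc i) f = trans (cong₂ _+_ (ℚ.*-zeroˡ (f zero)) (∑-δ i (f ∘ suc))) (ℚ.+-identityˡ _)

  δ-refl : ∀ {n} (i : Fin n) → δ i i ≡ 1ℚ
  δ-refl zero    = refl
  δ-refl (suc i) = δ-refl i

  δ-sym : ∀ {n} (i j : Fin n) → δ i j ≡ δ j i
  δ-sym zero    zero    = refl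
  δ-sym zero    (suc j) = refl
  δ-sym (suc i) zero    = refl
  δ-sym (suc i) (suc j) = δ-sym i j

  -- A certificate of positive semidefiniteness. Recursion on certificates gives closure under
  -- entrywise products, which is not apparent from nonnegativity of the form. `cast` stands in for
  -- function extensionality.
  data SOS {n} : Mat n → Set where
    square : (v : Fin n → ℚ) → SOS (λ i j → v i * v j)
    _⊕_    : ∀ {A B} → SOS A → SOS B → SOS (λ i j → A i j + B i j)
    scale  : ∀ {c A} → 0ℚ ≤ c → SOS A → SOS (λ i j → c * A i j)
    cast   : ∀ {A B} → (∀ i j → A i j ≡ B i j) → SOS A → SOS B

  SOS-∑ : ∀ {r n} {A : Fin r → Mat n} → (∀ a → SOS (A a)) → SOS (λ i j → ∑ λ a → A a i j)
  SOS-∑ {zero}  sos = cast (λ i j → refl) (square λ _ → 0ℚ)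
  SOS-∑ {suc r} sos = sos zero ⊕ SOS-∑ (sos ∘ suc)

  form : ∀ {n} → Mat n → (Fin n → ℚ) → ℚ
  form A x = ∑ λ i → ∑ λ j → x i * A i j * x j

  form-nonneg : ∀ {n} {A : Mat n} → SOS A → ∀ x → 0ℚ ≤ form A x
  form-nonneg (square v) x = subst (0ℚ ≤_)
    (trans (∑*∑ (λ i → x i * v i) (λ j → x j * v j)) (∑²-cong λ i j →
      solve 4 (λ v w x y → (x :* v) :* (y :* w) := x :* (v :* w) :* y) refl (v i) (v j) (x i) (x j)))
    (square-nonneg (∑ λ i → x i * v i))
  form-nonneg (_⊕_ {A} {B} a b) x = subst (0ℚ ≤_)
    (trans (sym (∑²-distrib-+ (λ i j → x i * A i j * x j) (λ i j → x i * B i j * x j))) (∑²-cong λ i j →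
      solve 4 (λ a b x y → x :* a :* y :+ x :* b :* y := x :* (a :+ b) :* y) refl (A i j) (B i j) (x i) (x j)))
    (+-nonneg (form-nonneg a x) (form-nonneg b x))
  form-nonneg (scale {c} {A} 0≤c a) x = subst (0ℚ ≤_)
    (trans (*-distribˡ-∑² c (λ i j → x i * A i j * x j)) (∑²-cong λ i j →
      solve 4 (λ c a x y → c :* (x :* a :* y) := x :* (c :* a) :* y) refl c (A i j) (x i) (x j)))
    (*-nonneg 0≤c (form-nonneg a x))
  form-nonneg (cast A≡B a) x = subst (0ℚ ≤_)
    (∑²-cong λ i j → cong (λ e → x i * e * x j) (A≡B i j)) (form-nonneg a x)

  -- Used with `quotient` and `remainder`: a Kronecker product is the entrywise product of the two
  -- pullbacks, so `SOS-schur` covers it.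
  SOS-reindex : ∀ {m n} {A : Mat n} (f : Fin m → Fin n) → SOS A → SOS (λ p q → A (f p) (f q))
  SOS-reindex f (square v)   = square (v ∘ f)
  SOS-reindex f (a ⊕ b)      = SOS-reindex f a ⊕ SOS-reindex f b
  SOS-reindex f (scale 0≤c a) = scale 0≤c (SOS-reindex f a)
  SOS-reindex f (cast A≡B a) = cast (λ p q → A≡B (f p) (f q)) (SOS-reindex f a)

  -- The Schur product theorem. For rank one, the entrywise product of v v^T and w w^T is the square
  -- of the entrywise product of v and w; bilinearity does the rest, unfolding the first certificate
  -- down to a square and then the second.
  SOS-schur : ∀ {n} {A B : Mat n} → SOS A → SOS B → SOS (λ i j → A i j * B i j)
  SOS-schur (square v) (square w) = cast
    (λ i j → solve 4 (λ a b c d → (a :* b) :* (c :* d) := (a :* c) :* (b :* d)) refl (v i) (w i) (v j) (w j))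
    (square λ i → v i * w i)
  SOS-schur {A = A} a@(square _) (_⊕_ {B} {C} b c) =
    cast (λ i j → sym (ℚ.*-distribˡ-+ (A i j) (B i j) (C i j))) (SOS-schur a b ⊕ SOS-schur a c)
  SOS-schur {A = A} a@(square _) (scale {c} {B} 0≤c b) = cast
    (λ i j → solve 3 (λ a b c → c :* (a :* b) := a :* (c :* b)) refl (A i j) (B i j) c)
    (scale 0≤c (SOS-schur a b))
  SOS-schur {A = A} a@(square _) (cast B≡C b) = cast (λ i j → cong (A i j *_) (B≡C i j)) (SOS-schur a b)
  SOS-schur {B = B} (_⊕_ {A} {C} a c) b =
    cast (λ i j → sym (ℚ.*-distribʳ-+ (B i j) (A i j) (C i j))) (SOS-schur a b ⊕ SOS-schur c b)
  SOS-schur {B = B} (scale {c} {A} 0≤c a) b =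
    cast (λ i j → sym (ℚ.*-assoc c (A i j) (B i j))) (scale 0≤c (SOS-schur a b))
  SOS-schur {B = B} (cast A≡C a) b = cast (λ i j → cong (_* B i j) (A≡C i j)) (SOS-schur a b)

  -- 2 (c I - E) = Σ E a b (e a - e b)(e a - e b)ᵀ.
  SOS-laplacian : ∀ {n c} {E : Mat n} → (∀ i j → E i j ≡ E j i) → (∀ i j → 0ℚ ≤ E i j) →
    (∀ i → ∑ (E i) ≡ c) → SOS (λ i j → c * δ i j - E i j)
  SOS-laplacian {n} {c} {E} E-sym 0≤E rowSum = cast eq
    (scale (ℚ.nonNegative⁻¹ ½) (SOS-∑ λ a → SOS-∑ λ b → scale (0≤E a b) (square λ i → δ a i - δ b i)))
    where
    open ≡-Reasoning
    cong₄ : ∀ {a b c d a' b' c' d'} → a ≡ a' → b ≡ b' → c ≡ c' → d ≡ d' → a - b - c + d ≡ a' - b' - c' + d'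
    cong₄ refl refl refl refl = refl
    inner : ∀ i j a → (∑ λ b → E a b * ((δ a i - δ b i) * (δ a j - δ b j)))
                    ≡ δ a i * (c * δ a j) - δ a i * E a j - δ a j * E a i + δ i j * E i a
    inner i j a = begin
      (∑ λ b → E a b * ((δ a i - δ b i) * (δ a j - δ b j)))
        ≡⟨ sum-cong-≗ (λ b → solve 5 (λ e x y z w → e :* ((x :- y) :* (z :- w)) :=
             e :* (x :* z) :- w :* (x :* e) :- y :* (z :* e) :+ y :* (w :* e))
             refl (E a b) (δ a i) (δ b i) (δ a j) (δ b j)) ⟩
      (∑ λ b → E a b * (δ a i * δ a j) - δ b j * (δ a i * E a b) - δ b i * (δ a j * E a b) + δ b i * (δ b j * E a b))
        ≡⟨ ∑-alternating (λ b → E a b * (δ a i * δ a j)) (λ b → δ b j * (δ a i * E a b))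
                         (λ b → δ b i * (δ a j * E a b)) (λ b → δ b i * (δ b j * E a b)) ⟩
      (∑ λ b → E a b * (δ a i * δ a j)) - (∑ λ b → δ b j * (δ a i * E a b))
        - (∑ λ b → δ b i * (δ a j * E a b)) + (∑ λ b → δ b i * (δ b j * E a b))
        ≡⟨ cong₄ (trans (sym (*-distribʳ-sum (δ a i * δ a j) (E a))) (cong (_* (δ a i * δ a j)) (rowSum a)))
             (∑-δ j (λ b → δ a i * E a b)) (∑-δ i (λ b → δ a j * E a b)) (∑-δ i (λ b → δ b j * E a b)) ⟩
      c * (δ a i * δ a j) - δ a i * E a j - δ a j * E a i + δ i j * E a i
        ≡⟨ cong₂ (λ u v → u - δ a i * E a j - δ a j * E a i + δ i j * v)
             (solve 3 (λ c x y → c :* (x :* y) := x :* (c :* y)) refl c (δ a i) (δ a j)) (E-sym a i) ⟩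
      δ a i * (c * δ a j) - δ a i * E a j - δ a j * E a i + δ i j * E i a ∎
    eq : ∀ i j → ½ * (∑ λ a → ∑ λ b → E a b * ((δ a i - δ b i) * (δ a j - δ b j))) ≡ c * δ i j - E i j
    eq i j = begin
      ½ * (∑ λ a → ∑ λ b → E a b * ((δ a i - δ b i) * (δ a j - δ b j)))
        ≡⟨ cong (½ *_) (trans (sum-cong-≗ (inner i j))
             (∑-alternating (λ a → δ a i * (c * δ a j)) (λ a → δ a i * E a j) (λ a → δ a j * E a i) (λ a → δ i j * E i a))) ⟩
      ½ * ((∑ λ a → δ a i * (c * δ a j)) - (∑ λ a → δ a i * E a j) - (∑ λ a → δ a j * E a i) + (∑ λ a → δ i j * E i a))
        ≡⟨ cong (½ *_) (cong₄ (∑-δ i (λ a → c * δ a j)) (∑-δ i (λ a → E a j)) (∑-δ j (λ a → E a i))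
             (trans (sym (*-distribˡ-sum (δ i j) (E i))) (cong (δ i j *_) (rowSum i)))) ⟩
      ½ * (c * δ i j - E i j - E j i + δ i j * c)
        ≡⟨ cong (λ e → ½ * (c * δ i j - E i j - e + δ i j * c)) (E-sym j i) ⟩
      ½ * (c * δ i j - E i j - E i j + δ i j * c)
        ≡⟨ solve 3 (λ c d e → con ½ :* (c :* d :- e :- e :+ d :* c) := c :* d :- e) refl c (δ i j) (E i j) ⟩
      c * δ i j - E i j ∎

  ∑-δ₁ : ∀ {n} (i : Fin n) → ∑ (δ i) ≡ 1ℚ
  ∑-δ₁ i = trans (sum-cong-≗ λ a → trans (δ-sym i a) (sym (ℚ.*-identityʳ (δ a i)))) (∑-δ i (λ _ → 1ℚ))

  -- The relaxation

  -- (1 + ⟨u i, u j⟩)/2 for unit vectors u i with sum zero; centred is the Gram matrix ⟨u i, u j⟩.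
  record Overlap n (c : ℚ) : Set where
    field
      E         : Mat n
      E-sym     : ∀ i j → E i j ≡ E j i
      E-refl    : ∀ i → E i i ≡ 1ℚ
      0≤E       : ∀ i j → 0ℚ ≤ E i j
      E≤1       : ∀ i j → E i j ≤ 1ℚ
      rowSum    : ∀ i → ∑ (E i) ≡ c
      centred   : SOS (λ i j → E i j + E i j - 1ℚ)

    δ≤E : ∀ i j → δ i j ≤ E i j
    δ≤E i j with i ≟ j
    ... | yes refl = ℚ.≤-reflexive (sym (E-refl i))
    ... | no _     = 0≤E i j

  module UnitVectors {n : ℕ} {c : ℚ} (size : ones n ≡ c + c) (a b : Fin n → ℚ)
    (unit : ∀ i → a i * a i + b i * b i ≡ 1ℚ) (∑a : ∑ a ≡ 0ℚ) (∑b : ∑ b ≡ 0ℚ) where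

    inner : Mat n
    inner i j = a i * a j + b i * b j

    -- For unit vectors, (1 + ⟨u, v⟩)/2 is |u + v|²/4 and its complement to 1 is |u - v|²/4, whence
    -- both bounds on the entries. The row sums are n/2 because the vectors sum to zero.
    unitOverlap : Overlap n c
    unitOverlap = record
      { E       = λ i j → ½ * (1ℚ + inner i j)
      ; E-sym   = λ i j → cong (λ e → ½ * (1ℚ + e)) (cong₂ _+_ (ℚ.*-comm (a i) (a j)) (ℚ.*-comm (b i) (b j)))
      ; E-refl  = λ i → cong (λ e → ½ * (1ℚ + e)) (unit i)
      ; 0≤E     = λ i j → *-nonneg 0≤½ (subst (0ℚ ≤_)
          (trans
            (solve 4 (λ a b a' b' →
              con ½ :* ((a :+ a') :* (a :+ a') :+ (b :+ b') :* (b :+ b')) :=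
              con ½ :* ((a :* a :+ b :* b) :+ (a' :* a' :+ b' :* b')) :+ (a :* a' :+ b :* b'))
              refl (a i) (b i) (a j) (b j))
            (cong₂ (λ u v → ½ * (u + v) + inner i j) (unit i) (unit j)))
          (*-nonneg 0≤½ (+-nonneg (square-nonneg (a i + a j)) (square-nonneg (b i + b j)))))
      ; E≤1     = λ i j → 0≤q-p⇒p≤q (subst (0ℚ ≤_)
          (trans
            (solve 4 (λ a b a' b' →
              con ½ :* (con ½ :* ((a :- a') :* (a :- a') :+ (b :- b') :* (b :- b'))) :=
              con ½ :* (con ½ :* ((a :* a :+ b :* b) :+ (a' :* a' :+ b' :* b')) :- (a :* a' :+ b :* b')))
              refl (a i) (b i) (a j) (b j))
            (trans (cong₂ (λ u v → ½ * (½ * (u + v) - inner i j)) (unit i) (unit j))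
              (solve 1 (λ e → con ½ :* (con 1ℚ :- e) := con 1ℚ :- con ½ :* (con 1ℚ :+ e)) refl (inner i j))))
          (*-nonneg 0≤½ (*-nonneg 0≤½ (+-nonneg (square-nonneg (a i - a j)) (square-nonneg (b i - b j))))))
      ; rowSum  = rows
      ; centred = cast (λ i j → solve 1 (λ e → e := con ½ :* (con 1ℚ :+ e) :+ con ½ :* (con 1ℚ :+ e) :- con 1ℚ)
                                  refl (inner i j))
                       (square a ⊕ square b)
      }
      where
      0≤½ = ℚ.nonNegative⁻¹ ½
      open ≡-Reasoning
      orthogonal : ∀ i → ∑ (inner i) ≡ 0ℚ
      orthogonal i = begin
        ∑ (inner i)
          ≡⟨ ∑-distrib-+ (λ j → a i * a j) (λ j → b i * b j) ⟩
        (∑ λ j → a i * a j) + (∑ λ j → b i * b j)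
          ≡⟨ cong₂ _+_ (*-distribˡ-sum (a i) a) (*-distribˡ-sum (b i) b) ⟨
        a i * ∑ a + b i * ∑ b
          ≡⟨ cong₂ (λ u v → a i * u + b i * v) ∑a ∑b ⟩
        a i * 0ℚ + b i * 0ℚ
          ≡⟨ cong₂ _+_ (ℚ.*-zeroʳ (a i)) (ℚ.*-zeroʳ (b i)) ⟩
        0ℚ ∎
      rows : ∀ i → (∑ λ j → ½ * (1ℚ + inner i j)) ≡ c
      rows i = begin
        (∑ λ j → ½ * (1ℚ + inner i j))
          ≡⟨ *-distribˡ-sum ½ (λ j → 1ℚ + inner i j) ⟨
        ½ * (∑ λ j → 1ℚ + inner i j)
          ≡⟨ cong (½ *_) (trans (∑-distrib-+ (λ _ → 1ℚ) (inner i)) (cong₂ _+_ size (orthogonal i))) ⟩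
        ½ * (c + c + 0ℚ)
          ≡⟨ solve 1 (λ c → con ½ :* (c :+ c :+ con 0ℚ) := c) refl c ⟩
        c ∎

  -- The reciprocals `h` and `g` enter only through the equations they satisfy, so the ring solver
  -- can treat them as variables.
  module Relaxation {n : ℕ} {c g h : ℚ} (size : ones n ≡ c + c)
    (ch≡1 : c * h ≡ 1ℚ) (cg≡1+g : c * g ≡ 1ℚ + g) (0≤g : 0ℚ ≤ g) (0≤h : 0ℚ ≤ h)
    (cities positions : Overlap n c) where

    open Overlap cities
    open Overlap positions using () renaming
      (E to Q; E-sym to Q-sym; E-refl to Q-refl; 0≤E to 0≤Q; E≤1 to Q≤1; rowSum to rowSumQ; centred to centredQ; δ≤E to δ≤Q)

    private
      0≤½h : 0ℚ ≤ ½ * h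
      0≤½h = *-nonneg (ℚ.nonNegative⁻¹ ½) 0≤h

    -- The block (i, j) is I/n on the diagonal, (Q - I)/(n (c - 1)) for two cities of the same
    -- cluster and (J - Q)/(n c) across; here n = 2c, h = 1/c and g = 1/(c - 1).
    entry : Fin n → Fin n → Fin n → Fin n → ℚ
    entry i k j l = ½ * h * (δ i j * δ k l + g * ((E i j - δ i j) * (Q k l - δ k l))
                                           + h * ((1ℚ - E i j) * (1ℚ - Q k l)))

    entry-sym : ∀ i k j l → entry i k j l ≡ entry j l i k
    entry-sym i k j l rewrite E-sym i j | Q-sym k l | δ-sym i j | δ-sym k l = refl

    δ-nonneg : ∀ i j → 0ℚ ≤ δ {n} i j
    δ-nonneg i j with i ≟ j
    ... | yes _ = ℚ.nonNegative⁻¹ 1ℚ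
    ... | no _  = ℚ.≤-refl

    entry-nonneg : ∀ i k j l → 0ℚ ≤ entry i k j l
    entry-nonneg i k j l = *-nonneg 0≤½h
      (+-nonneg (+-nonneg (*-nonneg (δ-nonneg i j) (δ-nonneg k l))
        (*-nonneg 0≤g (*-nonneg (p≤q⇒0≤q-p (δ≤E i j)) (p≤q⇒0≤q-p (δ≤Q k l)))))
        (*-nonneg 0≤h (*-nonneg (p≤q⇒0≤q-p (E≤1 i j)) (p≤q⇒0≤q-p (Q≤1 k l)))))

    private
      average : ∀ x → ∑ {n} (λ _ → ½ * h * x) ≡ x
      average x = begin
        ∑ {n} (λ _ → ½ * h * x)       ≡⟨ ∑-const n (½ * h * x) ⟩
        ones n * (½ * h * x)          ≡⟨ cong (_* (½ * h * x)) size ⟩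
        (c + c) * (½ * h * x)
          ≡⟨ solve 3 (λ c h x → (c :+ c) :* (con ½ :* h :* x) := c :* h :* x) refl c h x ⟩
        c * h * x                     ≡⟨ cong (_* x) ch≡1 ⟩
        1ℚ * x                        ≡⟨ ℚ.*-identityˡ x ⟩
        x                             ∎
        where open ≡-Reasoning

    -- For i = j the unit diagonals of `δ` and `E` kill the second and third summand of `entry`, and
    -- each diagonal block is I/n, since `½ * h` is 1/n. `∑-blockTrace` uses the diagonal of `Q` in
    -- the same way.
    ∑-diagonalBlocks : ∀ k l → (∑ λ i → entry i k i l) ≡ δ k l
    ∑-diagonalBlocks k l = trans (sum-cong-≗ λ i → lemma i (δ-refl i) (E-refl i)) (average (δ k l))
      where
      lemma : ∀ i → δ i i ≡ 1ℚ → E i i ≡ 1ℚ → entry i k i l ≡ ½ * h * δ k l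
      lemma i p q rewrite p | q = solve 4 (λ g h d e →
        con ½ :* h :* (con 1ℚ :* d :+ g :* ((con 1ℚ :- con 1ℚ) :* (e :- d)) :+ h :* ((con 1ℚ :- con 1ℚ) :* (con 1ℚ :- e)))
          := con ½ :* h :* d) refl g h (δ k l) (Q k l)

    ∑-blockTrace : ∀ i j → (∑ λ k → entry i k j k) ≡ δ i j
    ∑-blockTrace i j = trans (sum-cong-≗ λ k → lemma k (δ-refl k) (Q-refl k)) (average (δ i j))
      where
      lemma : ∀ k → δ k k ≡ 1ℚ → Q k k ≡ 1ℚ → entry i k j k ≡ ½ * h * δ i j
      lemma k p q rewrite p | q = solve 4 (λ g h d e →
        con ½ :* h :* (d :* con 1ℚ :+ g :* ((e :- d) :* (con 1ℚ :- con 1ℚ)) :+ h :* ((con 1ℚ :- e) :* (con 1ℚ :- con 1ℚ)))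
          := con ½ :* h :* d) refl g h (δ i j) (E i j)

    shifted : Mat (n ℕ.* n)
    shifted p q = entry (quotient {n} n p) (remainder {n} n p) (quotient {n} n q) (remainder {n} n q) - ½ * h * (½ * h)

    SOS-shifted : SOS shifted
    SOS-shifted = cast (λ p q → sym (split (quotient {n} n p) (remainder {n} n p) (quotient {n} n q) (remainder {n} n q)))
      (scale 0≤½h
        (scale 0≤½h (SOS-schur (SOS-reindex (quotient {n} n) centred) (SOS-reindex (remainder {n} n) centredQ))
         ⊕ scale (*-nonneg 0≤h 0≤g)
             (SOS-schur (SOS-reindex (quotient {n} n) (SOS-laplacian E-sym 0≤E rowSum))
                        (SOS-reindex (remainder {n} n) (SOS-laplacian Q-sym 0≤Q rowSumQ)))))
      where
      open ≡-Reasoning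
      -- This splits the coefficient of u v: the part `h` combines with h (1 - u)(1 - v) - h/2 into
      -- (h/2)(2u - 1)(2v - 1), and the part `h * g` goes to the Laplacians.
      g≡h+hg : g ≡ h + h * g
      g≡h+hg = begin
        g           ≡⟨ ℚ.*-identityˡ g ⟨
        1ℚ * g      ≡⟨ cong (_* g) ch≡1 ⟨
        c * h * g   ≡⟨ solve 3 (λ c g h → c :* h :* g := h :* (c :* g)) refl c g h ⟩
        h * (c * g) ≡⟨ cong (h *_) cg≡1+g ⟩
        h * (1ℚ + g) ≡⟨ solve 2 (λ g h → h :* (con 1ℚ :+ g) := h :+ h :* g) refl g h ⟩
        h + h * g   ∎
      split : ∀ i k j l → entry i k j l - ½ * h * (½ * h) ≡
        ½ * h * (½ * h * ((E i j + E i j - 1ℚ) * (Q k l + Q k l - 1ℚ))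
                 + h * g * ((c * δ i j - E i j) * (c * δ k l - Q k l)))
      split i k j l = begin
        ½ * h * (d * e + g * ((u - d) * (v - e)) + h * ((1ℚ - u) * (1ℚ - v))) - ½ * h * (½ * h)
          ≡⟨ solve 6 (λ g h d e u v →
               con ½ :* h :* (d :* e :+ g :* ((u :- d) :* (v :- e)) :+ h :* ((con 1ℚ :- u) :* (con 1ℚ :- v)))
                 :- con ½ :* h :* (con ½ :* h) :=
               con ½ :* h :* (g :* (u :* v) :+ h :* ((con 1ℚ :- u) :* (con 1ℚ :- v)) :- con ½ :* h
                 :+ ((con 1ℚ :+ g) :* (d :* e) :- g :* (d :* v) :- g :* (u :* e))))
               refl g h d e u v ⟩
        ½ * h * (g * (u * v) + h * ((1ℚ - u) * (1ℚ - v)) - ½ * h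
                 + ((1ℚ + g) * (d * e) - g * (d * v) - g * (u * e)))
          ≡⟨ cong₂ (λ x y → ½ * h * (x * (u * v) + h * ((1ℚ - u) * (1ℚ - v)) - ½ * h + y)) g≡h+hg tail ⟩
        ½ * h * ((h + h * g) * (u * v) + h * ((1ℚ - u) * (1ℚ - v)) - ½ * h
                 + (c * h * (c * g) * (d * e) - c * h * g * (d * v) - c * h * g * (u * e)))
          ≡⟨ solve 7 (λ c g h d e u v →
               con ½ :* h :* ((h :+ h :* g) :* (u :* v) :+ h :* ((con 1ℚ :- u) :* (con 1ℚ :- v)) :- con ½ :* h
                 :+ (c :* h :* (c :* g) :* (d :* e) :- c :* h :* g :* (d :* v) :- c :* h :* g :* (u :* e))) :=
               con ½ :* h :* (con ½ :* h :* ((u :+ u :- con 1ℚ) :* (v :+ v :- con 1ℚ))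
                 :+ h :* g :* ((c :* d :- u) :* (c :* e :- v))))
               refl c g h d e u v ⟩
        ½ * h * (½ * h * ((u + u - 1ℚ) * (v + v - 1ℚ)) + h * g * ((c * d - u) * (c * e - v))) ∎
        where
        d = δ i j
        e = δ k l
        u = E i j
        v = Q k l
        -- Factors c h = 1 are inserted and 1 + g becomes c g, which gives the coefficients of d e,
        -- d v and u e in h g (c d - u)(c e - v).
        tail : (1ℚ + g) * (d * e) - g * (d * v) - g * (u * e) ≡
               c * h * (c * g) * (d * e) - c * h * g * (d * v) - c * h * g * (u * e)
        tail rewrite ch≡1 | cg≡1+g = solve 5 (λ g d e u v →
          (con 1ℚ :+ g) :* (d :* e) :- g :* (d :* v) :- g :* (u :* e) :=
          con 1ℚ :* (con 1ℚ :+ g) :* (d :* e) :- con 1ℚ :* g :* (d :* v) :- con 1ℚ :* g :* (u :* e))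
          refl g d e u v

    -- `crisp` makes each E i j either 0 or 1. For 1 the left side vanishes; for 0 also `δ i j` is
    -- 0, only the last summand of `entry` survives, and equality holds. In both cases the slack is
    -- ½ h² E (1 - Q), so one identity replaces the case split.
    entry-cut : (∀ i j → E i j * (1ℚ - E i j) ≡ 0ℚ) → ∀ i k j l →
      (1ℚ - E i j) * entry i k j l ≤ ½ * h * h * (1ℚ - Q k l)
    entry-cut crisp i k j l = 0≤q-p⇒p≤q (subst (0ℚ ≤_) eq
      (*-nonneg (*-nonneg 0≤½h 0≤h) (*-nonneg (0≤E i j) (p≤q⇒0≤q-p (Q≤1 k l)))))
      where
      open ≡-Reasoning
      d = δ i j
      e = δ k l
      u = E i j
      v = Q k l
      disjoint : (1ℚ - u) * d ≡ 0ℚ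
      disjoint with i ≟ j
      ... | yes refl = cong (λ z → (1ℚ - z) * 1ℚ) (E-refl i)
      ... | no _     = ℚ.*-zeroʳ (1ℚ - u)
      eq : ½ * h * h * (u * (1ℚ - v)) ≡ ½ * h * h * (1ℚ - v) - (1ℚ - u) * entry i k j l
      eq = begin
        ½ * h * h * (u * (1ℚ - v))
          -- The zeros are placeholders for (1 - u) d and u (1 - u), which the next step puts in;
          -- the remaining identity is polynomial.
          ≡⟨ solve 5 (λ g h e u v →
               con ½ :* h :* h :* (u :* (con 1ℚ :- v)) :=
               con ½ :* h :* h :* (con 1ℚ :- v) :- con ½ :* h :* (con 0ℚ :* e :+ g :* ((con 0ℚ :- con 0ℚ) :* (v :- e))
                 :+ h :* ((con 1ℚ :- u :- con 0ℚ) :* (con 1ℚ :- v))))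
               refl g h e u v ⟩
        ½ * h * h * (1ℚ - v) - ½ * h * (0ℚ * e + g * ((0ℚ - 0ℚ) * (v - e)) + h * ((1ℚ - u - 0ℚ) * (1ℚ - v)))
          ≡⟨ cong₂ (λ x y → ½ * h * h * (1ℚ - v) - ½ * h * (x * e + g * ((y - x) * (v - e))
               + h * ((1ℚ - u - y) * (1ℚ - v)))) disjoint (crisp i j) ⟨
        ½ * h * h * (1ℚ - v) - ½ * h * ((1ℚ - u) * d * e + g * ((u * (1ℚ - u) - (1ℚ - u) * d) * (v - e))
          + h * ((1ℚ - u - u * (1ℚ - u)) * (1ℚ - v)))
          ≡⟨ solve 6 (λ g h d e u v →
               con ½ :* h :* h :* (con 1ℚ :- v) :- con ½ :* h :* ((con 1ℚ :- u) :* d :* e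
                 :+ g :* ((u :* (con 1ℚ :- u) :- (con 1ℚ :- u) :* d) :* (v :- e))
                 :+ h :* ((con 1ℚ :- u :- u :* (con 1ℚ :- u)) :* (con 1ℚ :- v))) :=
               con ½ :* h :* h :* (con 1ℚ :- v) :- (con 1ℚ :- u) :* (con ½ :* h :* (d :* e
                 :+ g :* ((u :- d) :* (v :- e)) :+ h :* ((con 1ℚ :- u) :* (con 1ℚ :- v)))))
               refl g h d e u v ⟩
        ½ * h * h * (1ℚ - v) - (1ℚ - u) * entry i k j l ∎

  -- The positions: points on the unit circle

  -- Serves twice: with a coordinate of the arc it gives the positions, with the constant 1 the
  -- signs of the clusters. In both cases the two halves cancel in the sum.
  antipodal : ℕ → (ℕ → ℚ) → ℕ → ℚ
  antipodal m f j = [ (λ _ → f j) , (λ _ → - f (j ℕ.∸ m)) ]′ (ℕ.<-≤-connex j m)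

  antipodal-< : ∀ {m j} f → j ℕ.< m → antipodal m f j ≡ f j
  antipodal-< {m} {j} f j<m with ℕ.<-≤-connex j m
  ... | inj₁ _   = refl
  ... | inj₂ m≤j = contradiction j<m (ℕ.≤⇒≯ m≤j)

  antipodal-+ : ∀ m f j → antipodal m f (m ℕ.+ j) ≡ - f j
  antipodal-+ m f j with ℕ.<-≤-connex (m ℕ.+ j) m
  ... | inj₁ m+j<m = contradiction m+j<m (ℕ.m+n≮m m j)
  ... | inj₂ _     = cong (-_ ∘ f) (ℕ.m+n∸m≡n m j)

  ∑-antipodal : ∀ m f → ∑ {m ℕ.+ m} (λ i → antipodal m f (toℕ i)) ≡ 0ℚ
  ∑-antipodal m f = begin
    ∑ {m ℕ.+ m} (λ i → antipodal m f (toℕ i))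
      ≡⟨ ∑-↑ m {m} (λ i → antipodal m f (toℕ i)) ⟩
    ∑ {m} (λ i → antipodal m f (toℕ (i ↑ˡ m))) + ∑ {m} (λ i → antipodal m f (toℕ (m ↑ʳ i)))
      ≡⟨ cong₂ _+_
           (sum-cong-≗ {m} λ i → trans (cong (antipodal m f) (toℕ-↑ˡ i m)) (antipodal-< f (toℕ<n i)))
           (sum-cong-≗ {m} λ i → trans (cong (antipodal m f) (toℕ-↑ʳ m i)) (antipodal-+ m f (toℕ i))) ⟩
    ∑ {m} (λ i → f (toℕ i)) + ∑ {m} (λ i → - f (toℕ i))
      ≡⟨ ∑-distrib-+ {m} (λ i → f (toℕ i)) (λ i → - f (toℕ i)) ⟨
    ∑ {m} (λ i → f (toℕ i) - f (toℕ i))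
      ≡⟨ trans (sum-cong-≗ {m} λ i → ℚ.+-inverseʳ (f (toℕ i))) (∑-zero m) ⟩
    0ℚ ∎
    where open ≡-Reasoning

  -- Index and sign do not depend on `g`, so they are common to both coordinates of a point.
  antipodal-sign : ∀ m j → ∃ λ i →
    (∀ g → antipodal m g j ≡ g i) ⊎ (∀ g → antipodal m g j ≡ - g i)
  antipodal-sign m j with ℕ.<-≤-connex j m
  ... | inj₁ _ = j , inj₁ λ g → refl
  ... | inj₂ _ = j ℕ.∸ m , inj₂ λ g → refl

  private
    1+t²-positive : ∀ t → Positive (1ℚ + t * t)
    1+t²-positive t = ℚ.pos+nonNeg⇒pos 1ℚ (t * t) {{nonNegative (square-nonneg t)}}

  ρ : ℚ → ℚ
  ρ t = (1/ (1ℚ + t * t)) {{ℚ.pos⇒nonZero (1ℚ + t * t) {{1+t²-positive t}}}}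

  ρ-inverse : ∀ t → ρ t * (1ℚ + t * t) ≡ 1ℚ
  ρ-inverse t = ℚ.*-inverseˡ (1ℚ + t * t) {{ℚ.pos⇒nonZero (1ℚ + t * t) {{1+t²-positive t}}}}

  ρ-nonneg : ∀ t → 0ℚ ≤ ρ t
  ρ-nonneg t = ℚ.<⇒≤ (ℚ.positive⁻¹ (ρ t) {{ℚ.1/pos⇒pos (1ℚ + t * t) {{1+t²-positive t}}}})

  ρ≤1 : ∀ t → ρ t ≤ 1ℚ
  ρ≤1 t = 0≤q-p⇒p≤q (subst (0ℚ ≤_)
    (trans (solve 2 (λ r t → r :* (t :* t) := r :* (con 1ℚ :+ t :* t) :- r) refl (ρ t) t)
           (cong (_- ρ t) (ρ-inverse t)))
    (*-nonneg (ρ-nonneg t) (square-nonneg t)))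

  -- The rational parametrization of the unit circle by t = tan(θ/2), which keeps the Gram matrix
  -- rational. The range -1 ≤ t ≤ 1 is a half circle from (0, -1) to (0, 1).
  circleˣ circleʸ : ℚ → ℚ
  circleˣ t = (1ℚ - t * t) * ρ t
  circleʸ t = (t + t) * ρ t

  circle-unit : ∀ t → circleˣ t * circleˣ t + circleʸ t * circleʸ t ≡ 1ℚ
  circle-unit t = trans
    (solve 2 (λ r t → (con 1ℚ :- t :* t) :* r :* ((con 1ℚ :- t :* t) :* r) :+ (t :+ t) :* r :* ((t :+ t) :* r) :=
                      r :* (con 1ℚ :+ t :* t) :* (r :* (con 1ℚ :+ t :* t))) refl (ρ t) t)
    (cong₂ _*_ (ρ-inverse t) (ρ-inverse t))

  circle-chord : ∀ s t → 1ℚ - ½ * (1ℚ + (circleˣ s * circleˣ t + circleʸ s * circleʸ t)) ≤ (t - s) * (t - s)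
  circle-chord s t = begin
    1ℚ - ½ * (1ℚ + (circleˣ s * circleˣ t + circleʸ s * circleʸ t))
      ≡⟨ solve 1 (λ x → con 1ℚ :- con ½ :* (con 1ℚ :+ x) := con ½ :* (con 1ℚ :* con 1ℚ :- x))
         refl (circleˣ s * circleˣ t + circleʸ s * circleʸ t) ⟩
    ½ * (1ℚ * 1ℚ - (circleˣ s * circleˣ t + circleʸ s * circleʸ t))
      ≡⟨ cong₂ (λ x y → ½ * (x * y - (circleˣ s * circleˣ t + circleʸ s * circleʸ t))) (ρ-inverse s) (ρ-inverse t) ⟨
    ½ * (ρ s * (1ℚ + s * s) * (ρ t * (1ℚ + t * t)) - (circleˣ s * circleˣ t + circleʸ s * circleʸ t))
      ≡⟨ solve 4 (λ r r' s t →
           con ½ :* (r :* (con 1ℚ :+ s :* s) :* (r' :* (con 1ℚ :+ t :* t)) :-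
             ((con 1ℚ :- s :* s) :* r :* ((con 1ℚ :- t :* t) :* r') :+ (s :+ s) :* r :* ((t :+ t) :* r'))) :=
           (t :- s) :* (t :- s) :* (r :* r')) refl (ρ s) (ρ t) s t ⟩
    (t - s) * (t - s) * (ρ s * ρ t)
      ≤⟨ ℚ.*-monoˡ-≤-nonNeg ((t - s) * (t - s)) {{nonNegative (square-nonneg (t - s))}} ρρ≤1 ⟩
    (t - s) * (t - s) * 1ℚ
      ≡⟨ ℚ.*-identityʳ _ ⟩
    (t - s) * (t - s) ∎
    where
    open ℚ.≤-Reasoning
    ρρ≤1 : ρ s * ρ t ≤ 1ℚ
    ρρ≤1 = ℚ.≤-trans (ℚ.*-monoˡ-≤-nonNeg (ρ s) {{nonNegative (ρ-nonneg s)}} (ρ≤1 t))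
                     (ℚ.≤-trans (ℚ.≤-reflexive (ℚ.*-identityʳ (ρ s))) (ρ≤1 s))

  module Arc {m : ℕ} {h : ℚ} .{{_ : ℕ.NonZero m}} (ch≡1 : ones m * h ≡ 1ℚ) where

    private
      n : ℕ
      n = m ℕ.+ m
      instance
        n≢0 : ℕ.NonZero n
        n≢0 = ℕ.>-nonZero (ℕ.≤-trans (ℕ.>-nonZero⁻¹ m) (ℕ.m≤m+n m m))

    -- The circle is run through by t from -1 to 1 and then by the antipodes of this half.
    τ : ℕ → ℚ
    τ j = ones j * (h + h) - 1ℚ

    τ-step : ∀ j → τ (suc j) - τ j ≡ h + h
    τ-step j = solve 2 (λ x h → ((con 1ℚ :+ x) :* h :- con 1ℚ) :- (x :* h :- con 1ℚ) := h) refl (ones j) (h + h)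

    τ-start : τ 0 ≡ - 1ℚ
    τ-start = trans (cong (_- 1ℚ) (ℚ.*-zeroˡ (h + h))) (ℚ.+-identityˡ (- 1ℚ))

    τ-end : τ m ≡ 1ℚ
    τ-end = trans (solve 2 (λ c h → c :* (h :+ h) :- con 1ℚ := c :* h :+ c :* h :- con 1ℚ) refl (ones m) h)
                  (cong (λ x → x + x - 1ℚ) ch≡1)

    point : (ℚ → ℚ) → ℕ → ℚ
    point u = antipodal m (u ∘ τ)

    module _ (u : ℚ → ℚ) (u-odd : u 1ℚ ≡ - u (- 1ℚ)) where

      private
        joined : u (τ m) ≡ - u (τ 0)
        joined = trans (cong u τ-end) (trans u-odd (cong (λ t → - u t) (sym τ-start)))

      -- The case j = m is included although m already belongs to the second half: by `u-odd` the
      -- arc ends where its antipodal copy begins. `point-second` does the same for the return to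
      -- position 0. Thus the steps across the two joints look like all others.
      point-first : ∀ {j} → j ℕ.≤ m → point u j ≡ u (τ j)
      point-first {j} j≤m with ℕ.m≤n⇒m<n∨m≡n j≤m
      ... | inj₁ j<m  = antipodal-< (u ∘ τ) j<m
      ... | inj₂ refl = trans (cong (point u) (sym (ℕ.+-identityʳ m)))
                              (trans (antipodal-+ m (u ∘ τ) 0) (sym joined))

      point-second : ∀ {j} → j ℕ.≤ m → point u ((m ℕ.+ j) % n) ≡ - u (τ j)
      point-second {j} j≤m with ℕ.m≤n⇒m<n∨m≡n j≤m
      ... | inj₁ j<m  = trans (cong (point u) (m<n⇒m%n≡m (ℕ.+-monoʳ-< m j<m))) (antipodal-+ m (u ∘ τ) j)
      ... | inj₂ refl = begin
        point u (n % n) ≡⟨ cong (point u) (n%n≡0 n) ⟩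
        point u 0       ≡⟨ antipodal-< (u ∘ τ) (ℕ.>-nonZero⁻¹ m) ⟩
        u (τ 0)         ≡⟨ solve 1 (λ x → x := :- (:- x)) refl (u (τ 0)) ⟩
        - (- u (τ 0))   ≡⟨ cong -_ joined ⟨
        - u (τ m)       ∎
        where open ≡-Reasoning

    -- Spelled as 1 minus the entry of `unitOverlap`, so that a bound on it is definitionally a
    -- bound on 1 - Q.
    chord : ℚ → ℚ → ℚ → ℚ → ℚ
    chord x y x' y' = 1ℚ - ½ * (1ℚ + (x * x' + y * y'))

    private
      chord-cong : ∀ {x y x' y' u v u' v'} → x ≡ u → y ≡ v → x' ≡ u' → y' ≡ v' → chord x y x' y' ≡ chord u v u' v'
      chord-cong refl refl refl refl = refl

      chord-neg : ∀ x y x' y' → chord (- x) (- y) (- x') (- y') ≡ chord x y x' y'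
      chord-neg = solve 4 (λ x y x' y' → con 1ℚ :- con ½ :* (con 1ℚ :+ ((:- x) :* (:- x') :+ (:- y) :* (:- y')))
        := con 1ℚ :- con ½ :* (con 1ℚ :+ (x :* x' :+ y :* y'))) refl

      arc-bound : ∀ i → chord (circleˣ (τ i)) (circleʸ (τ i)) (circleˣ (τ (suc i))) (circleʸ (τ (suc i))) ≤ (h + h) * (h + h)
      arc-bound i = ℚ.≤-trans (circle-chord (τ i) (τ (suc i))) (ℚ.≤-reflexive (cong (λ x → x * x) (τ-step i)))

      oddˣ : circleˣ 1ℚ ≡ - circleˣ (- 1ℚ)
      oddˣ = refl

      oddʸ : circleʸ 1ℚ ≡ - circleʸ (- 1ℚ)
      oddʸ = refl

    StepBound : ℕ → ℕ → Set
    StepBound j k = chord (point circleˣ j) (point circleʸ j) (point circleˣ k) (point circleʸ k) ≤ (h + h) * (h + h)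

    -- Negating both endpoints preserves the chord, so the second half, wraparound included, repeats
    -- the estimate on the first.
    step-bound : ∀ {j} → j ℕ.< n → StepBound j (suc j % n)
    step-bound {j} j<n = [ first , second ]′ (ℕ.<-≤-connex j m)
      where
      first : j ℕ.< m → StepBound j (suc j % n)
      first j<m = subst (StepBound j)
        (sym (m<n⇒m%n≡m (ℕ.≤-<-trans j<m (ℕ.m<m+n m (ℕ.>-nonZero⁻¹ m)))))
        (ℚ.≤-trans (ℚ.≤-reflexive (chord-cong
          (point-first circleˣ oddˣ (ℕ.<⇒≤ j<m)) (point-first circleʸ oddʸ (ℕ.<⇒≤ j<m))
          (point-first circleˣ oddˣ j<m) (point-first circleʸ oddʸ j<m)))
          (arc-bound j))
      i : ℕ
      i = j ℕ.∸ m
      second : m ℕ.≤ j → StepBound j (suc j % n)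
      second m≤j = subst (λ k → StepBound k (suc k % n)) (ℕ.m+[n∸m]≡n m≤j)
        (subst (λ k → StepBound (m ℕ.+ i) (k % n)) (ℕ.+-suc m i)
        (ℚ.≤-trans (ℚ.≤-reflexive (trans (chord-cong
            (antipodal-+ m (circleˣ ∘ τ) i) (antipodal-+ m (circleʸ ∘ τ) i)
            (point-second circleˣ oddˣ i<m) (point-second circleʸ oddʸ i<m))
            (chord-neg (circleˣ (τ i)) (circleʸ (τ i)) (circleˣ (τ (suc i))) (circleʸ (τ (suc i))))))
          (arc-bound i)))
        where
        i<m : i ℕ.< m
        i<m = ℕ.+-cancelˡ-< m i m (subst (ℕ._< n) (sym (ℕ.m+[n∸m]≡n m≤j)) j<n)

  positions : ∀ {m h} .{{_ : ℕ.NonZero m}} → ones m * h ≡ 1ℚ → Overlap (m ℕ.+ m) (ones m)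
  positions {m} ch≡1 = UnitVectors.unitOverlap (ones-+ m m) (λ i → point circleˣ (toℕ i)) (λ i → point circleʸ (toℕ i))
    (λ i → unit (antipodal-sign m (toℕ i))) (∑-antipodal m (circleˣ ∘ τ)) (∑-antipodal m (circleʸ ∘ τ))
    where
    open Arc {m} ch≡1
    unit : ∀ {j} → (∃ λ i → (∀ g → antipodal m g j ≡ g i) ⊎ (∀ g → antipodal m g j ≡ - g i)) →
      point circleˣ j * point circleˣ j + point circleʸ j * point circleʸ j ≡ 1ℚ
    unit (i , inj₁ p) = trans (cong₂ (λ x y → x * x + y * y) (p (circleˣ ∘ τ)) (p (circleʸ ∘ τ))) (circle-unit (τ i))
    unit (i , inj₂ p) = trans (cong₂ (λ x y → x * x + y * y) (p (circleˣ ∘ τ)) (p (circleʸ ∘ τ)))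
      (trans (solve 2 (λ x y → (:- x) :* (:- x) :+ (:- y) :* (:- y) := x :* x :+ y :* y)
          refl (circleˣ (τ i)) (circleʸ (τ i)))
             (circle-unit (τ i)))

  -- Tours

  -- The path is a function on all of ℕ, so a later piece of it is a shift and a closed path is an
  -- equation z n = z 0.
  pathLength : ∀ {A : Set} → (A → A → ℚ) → (ℕ → A) → ℕ → ℚ
  pathLength d z k = ∑ {k} λ i → d (z (toℕ i)) (z (suc (toℕ i)))

  pathLength-+ : ∀ {A : Set} (d : A → A → ℚ) z a b →
    pathLength d z (a ℕ.+ b) ≡ pathLength d z a + pathLength d (z ∘ (a ℕ.+_)) b
  pathLength-+ d z zero    b = sym (ℚ.+-identityˡ _)
  pathLength-+ d z (suc a) b = trans (cong (d (z 0) (z 1) +_) (pathLength-+ d (z ∘ suc) a b))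
    (sym (ℚ.+-assoc (d (z 0) (z 1)) _ _))

  module Metric {A : Set} (d : A → A → ℚ) (d-refl : ∀ x → d x x ≡ 0ℚ) (d-sym : ∀ x y → d x y ≡ d y x)
    (d-triangle : ∀ x y w → d x y ≤ d x w + d w y) where

    d≤pathLength : ∀ z k → d (z 0) (z k) ≤ pathLength d z k
    d≤pathLength z zero    = ℚ.≤-reflexive (d-refl (z 0))
    d≤pathLength z (suc k) = ℚ.≤-trans (d-triangle (z 0) (z (suc k)) (z 1))
      (ℚ.+-monoʳ-≤ (d (z 0) (z 1)) (d≤pathLength (z ∘ suc) k))

    private
      -- The points x = z a and y = z (a + p) cut the closed path in three. The middle piece is at
      -- least d x y; the outer two lead from y through z 0 to x and together are at least d x y
      -- again.
      detour : ∀ z a p q → z (a ℕ.+ (p ℕ.+ q)) ≡ z 0 →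
        d (z a) (z (a ℕ.+ p)) + d (z a) (z (a ℕ.+ p)) ≤ pathLength d z (a ℕ.+ (p ℕ.+ q))
      detour z a p q closed = begin
        d x y + d x y
          ≤⟨ ℚ.+-monoʳ-≤ (d x y) (d-triangle x y (z 0)) ⟩
        d x y + (d x (z 0) + d (z 0) y)
          ≡⟨ cong₂ (λ u v → d x y + (u + v)) (d-sym x (z 0)) (trans (d-sym (z 0) y) (cong (d y) (sym closed))) ⟩
        d x y + (d (z 0) x + d y (z (a ℕ.+ (p ℕ.+ q))))
          ≡⟨ solve 3 (λ u v w → u :+ (v :+ w) := v :+ (u :+ w)) refl (d x y) (d (z 0) x) (d y (z (a ℕ.+ (p ℕ.+ q)))) ⟩
        d (z 0) x + (d x y + d y (z (a ℕ.+ (p ℕ.+ q))))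
          ≤⟨ ℚ.+-mono-≤ (d≤pathLength z a) (ℚ.+-mono-≤
               (subst (λ i → d (z i) y ≤ pathLength d z₁ p) (ℕ.+-identityʳ a) (d≤pathLength z₁ p))
               (subst (λ i → d (z (a ℕ.+ i)) (z (a ℕ.+ (p ℕ.+ q))) ≤ pathLength d z₂ q)
                 (ℕ.+-identityʳ p) (d≤pathLength z₂ q))) ⟩
        pathLength d z a + (pathLength d z₁ p + pathLength d z₂ q)
          ≡⟨ cong (pathLength d z a +_) (pathLength-+ d z₁ p q) ⟨
        pathLength d z a + pathLength d z₁ (p ℕ.+ q)
          ≡⟨ pathLength-+ d z a (p ℕ.+ q) ⟨
        pathLength d z (a ℕ.+ (p ℕ.+ q)) ∎
        where
        open ℚ.≤-Reasoning
        x = z a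
        y = z (a ℕ.+ p)
        z₁ z₂ : ℕ → A
        z₁ = z ∘ (a ℕ.+_)
        z₂ = z₁ ∘ (p ℕ.+_)

      ordered : ∀ z {n a b} → z n ≡ z 0 → a ℕ.≤ b → b ℕ.≤ n → d (z a) (z b) + d (z a) (z b) ≤ pathLength d z n
      ordered z {n} {a} {b} closed a≤b b≤n = subst₂ (λ i k → d (z a) (z i) + d (z a) (z i) ≤ pathLength d z k)
        (ℕ.m+[n∸m]≡n a≤b) total (detour z a (b ℕ.∸ a) (n ℕ.∸ b) (trans (cong z total) closed))
        where
        total : a ℕ.+ (b ℕ.∸ a ℕ.+ (n ℕ.∸ b)) ≡ n
        total = trans (sym (ℕ.+-assoc a (b ℕ.∸ a) (n ℕ.∸ b)))
          (trans (cong (ℕ._+ (n ℕ.∸ b)) (ℕ.m+[n∸m]≡n a≤b)) (ℕ.m+[n∸m]≡n b≤n))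

    closedPath-bound : ∀ z {n a b} → z n ≡ z 0 → a ℕ.≤ n → b ℕ.≤ n →
      d (z a) (z b) + d (z a) (z b) ≤ pathLength d z n
    closedPath-bound z {n} {a} {b} closed a≤n b≤n with ℕ.≤-total a b
    ... | inj₁ a≤b = ordered z closed a≤b b≤n
    ... | inj₂ b≤a = subst (λ e → e + e ≤ pathLength d z n) (d-sym (z b) (z a)) (ordered z closed b≤a a≤n)

  module _ {n : ℕ} .{{_ : ℕ.NonZero n}} where

    toℕ-mod : ∀ (k : Fin n) → toℕ k mod n ≡ k
    toℕ-mod k = toℕ-injective (trans (toℕ-fromℕ< (m%n<n (toℕ k) n)) (m<n⇒m%n≡m (toℕ<n k)))

    tourLength : (Fin n → Fin n → ℚ) → Permutation′ n → ℚ
    tourLength d σ = ∑ λ k → d (σ ⟨$⟩ʳ k) (σ ⟨$⟩ʳ next k)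

    tourLength≡pathLength : ∀ d σ → tourLength d σ ≡ pathLength d (λ j → σ ⟨$⟩ʳ (j mod n)) n
    tourLength≡pathLength d σ = sum-cong-≗ λ k → cong (λ l → d (σ ⟨$⟩ʳ l) (σ ⟨$⟩ʳ next k)) (sym (toℕ-mod k))

    tourLength-bound : ∀ (d : Fin n → Fin n → ℚ) → (∀ x → d x x ≡ 0ℚ) → (∀ x y → d x y ≡ d y x) →
      (∀ x y w → d x y ≤ d x w + d w y) → ∀ σ i j → d i j + d i j ≤ tourLength d σ
    tourLength-bound d d-refl d-sym d-triangle σ i j = subst₂ _≤_
      (cong₂ (λ x y → d x y + d x y) (visit i) (visit j)) (sym (tourLength≡pathLength d σ))
      (Metric.closedPath-bound d d-refl d-sym d-triangle z closed (ℕ.<⇒≤ (toℕ<n (σ ⟨$⟩ˡ i))) (ℕ.<⇒≤ (toℕ<n (σ ⟨$⟩ˡ j))))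
      where
      z : ℕ → Fin n
      z k = σ ⟨$⟩ʳ (k mod n)
      visit : ∀ i → z (toℕ (σ ⟨$⟩ˡ i)) ≡ i
      visit i = trans (cong (σ ⟨$⟩ʳ_) (toℕ-mod (σ ⟨$⟩ˡ i))) (inverseʳ σ)
      closed : z n ≡ z 0
      closed = cong (σ ⟨$⟩ʳ_) (toℕ-injective (trans (toℕ-fromℕ< (m%n<n n n))
        (trans (trans (n%n≡0 n) (sym (m<n⇒m%n≡m (ℕ.>-nonZero⁻¹ n)))) (sym (toℕ-fromℕ< (m%n<n 0 n))))))

  -- The cities: two clusters

  IsSign : ℚ → Set
  IsSign x = x ≡ 1ℚ ⊎ x ≡ - 1ℚ

  -- Kept in the form 1 - E i j for the overlap E of the vectors (x , 0).
  cut : ℚ → ℚ → ℚ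
  cut x y = 1ℚ - ½ * (1ℚ + (x * y + 0ℚ * 0ℚ))

  cut-triangle : ∀ {x y w} → IsSign x → IsSign y → IsSign w → cut x y ≤ cut x w + cut w y
  cut-triangle (inj₁ refl) (inj₁ refl) (inj₁ refl) = ℚ.≤ᵇ⇒≤ tt
  cut-triangle (inj₁ refl) (inj₁ refl) (inj₂ refl) = ℚ.≤ᵇ⇒≤ tt
  cut-triangle (inj₁ refl) (inj₂ refl) (inj₁ refl) = ℚ.≤ᵇ⇒≤ tt
  cut-triangle (inj₁ refl) (inj₂ refl) (inj₂ refl) = ℚ.≤ᵇ⇒≤ tt
  cut-triangle (inj₂ refl) (inj₁ refl) (inj₁ refl) = ℚ.≤ᵇ⇒≤ tt
  cut-triangle (inj₂ refl) (inj₁ refl) (inj₂ refl) = ℚ.≤ᵇ⇒≤ tt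
  cut-triangle (inj₂ refl) (inj₂ refl) (inj₁ refl) = ℚ.≤ᵇ⇒≤ tt
  cut-triangle (inj₂ refl) (inj₂ refl) (inj₂ refl) = ℚ.≤ᵇ⇒≤ tt

  cut-refl : ∀ {x} → IsSign x → cut x x ≡ 0ℚ
  cut-refl (inj₁ refl) = refl
  cut-refl (inj₂ refl) = refl

  cut-crisp : ∀ {x y} → IsSign x → IsSign y → ½ * (1ℚ + (x * y + 0ℚ * 0ℚ)) * cut x y ≡ 0ℚ
  cut-crisp (inj₁ refl) (inj₁ refl) = refl
  cut-crisp (inj₁ refl) (inj₂ refl) = refl
  cut-crisp (inj₂ refl) (inj₁ refl) = refl
  cut-crisp (inj₂ refl) (inj₂ refl) = refl

  telescope : ∀ (v : ℕ → ℚ) k → ∑ {k} (λ i → v (suc (toℕ i)) - v (toℕ i)) ≡ v k - v 0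
  telescope v zero    = sym (ℚ.+-inverseʳ (v 0))
  telescope v (suc k) = trans (cong (v 1 - v 0 +_) (telescope (v ∘ suc) k))
    (solve 3 (λ a b c → b :- a :+ (c :- b) := c :- a) refl (v 0) (v 1) (v (suc k)))

  -- Every point before the last has the same distances as z 0, in particular distance 0 from it.
  -- Subtracting that 0 turns each step into a difference of distances from z 0, and the sum
  -- telescopes. It is applied to one cluster followed by the first city of the other.
  pathLength-straight : ∀ {A : Set} (d : A → A → ℚ) (z : ℕ → A) k → (∀ j → d (z j) (z j) ≡ 0ℚ) →
    (∀ {j} → j ℕ.< k → ∀ w → d (z j) w ≡ d (z 0) w) → pathLength d z k ≡ d (z 0) (z k)
  pathLength-straight d z k d-refl together = begin
    pathLength d z k
      ≡⟨ sum-cong-≗ {k} (λ i → trans (sym (ℚ.+-identityʳ (d (z (toℕ i)) (z (suc (toℕ i))))))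
           (cong₂ _-_ (together (toℕ<n i) (z (suc (toℕ i))))
             (sym (trans (sym (together (toℕ<n i) (z (toℕ i)))) (d-refl (toℕ i)))))) ⟩
    ∑ {k} (λ i → d (z 0) (z (suc (toℕ i))) - d (z 0) (z (toℕ i)))
      ≡⟨ telescope (λ j → d (z 0) (z j)) k ⟩
    d (z 0) (z k) - d (z 0) (z 0)
      ≡⟨ cong (λ e → d (z 0) (z k) - e) (d-refl 0) ⟩
    d (z 0) (z k) - 0ℚ
      ≡⟨ ℚ.+-identityʳ _ ⟩
    d (z 0) (z k) ∎
    where open ≡-Reasoning

  module Clusters (m : ℕ) .{{_ : ℕ.NonZero m}} where

    private
      n : ℕ
      n = m ℕ.+ m
      instance
        n≢0 : ℕ.NonZero n
        n≢0 = ℕ.>-nonZero (ℕ.≤-trans (ℕ.>-nonZero⁻¹ m) (ℕ.m≤m+n m m))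

    side : Fin n → ℚ
    side i = antipodal m (λ _ → 1ℚ) (toℕ i)

    side-sign : ∀ i → IsSign (side i)
    side-sign i = go (antipodal-sign m (toℕ i))
      where
      go : ∀ {j} → (∃ λ i → (∀ g → antipodal m g j ≡ g i) ⊎ (∀ g → antipodal m g j ≡ - g i)) →
        IsSign (antipodal m (λ _ → 1ℚ) j)
      go (_ , inj₁ p) = inj₁ (p (λ _ → 1ℚ))
      go (_ , inj₂ p) = inj₂ (p (λ _ → 1ℚ))

    cities : Overlap n (ones m)
    cities = UnitVectors.unitOverlap (ones-+ m m) side (λ _ → 0ℚ) (λ i → unit (side-sign i))
      (∑-antipodal m (λ _ → 1ℚ)) (∑-zero n)
      where
      unit : ∀ {x} → IsSign x → x * x + 0ℚ * 0ℚ ≡ 1ℚ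
      unit (inj₁ refl) = refl
      unit (inj₂ refl) = refl

    dist : Mat n
    dist i j = cut (side i) (side j)

    dist-refl : ∀ i → dist i i ≡ 0ℚ
    dist-refl i = cut-refl (side-sign i)

    dist-sym : ∀ i j → dist i j ≡ dist j i
    dist-sym i j = cong (λ e → 1ℚ - ½ * (1ℚ + (e + 0ℚ * 0ℚ))) (ℚ.*-comm (side i) (side j))

    dist-triangle : ∀ i j k → dist i j ≤ dist i k + dist k j
    dist-triangle i j k = cut-triangle (side-sign i) (side-sign j) (side-sign k)

    private
      z : ℕ → Fin n
      z j = j mod n

      side-z : ∀ j → side (z j) ≡ antipodal m (λ _ → 1ℚ) (j % n)
      side-z j = cong (antipodal m (λ _ → 1ℚ)) (toℕ-fromℕ< (m%n<n j n))

      side-first : ∀ {j} → j ℕ.< m → side (z j) ≡ 1ℚ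
      side-first {j} j<m = trans (side-z j) (trans
        (cong (antipodal m (λ _ → 1ℚ)) (m<n⇒m%n≡m (ℕ.<-≤-trans j<m (ℕ.m≤m+n m m))))
        (antipodal-< (λ _ → 1ℚ) j<m))

      side-second : ∀ {j} → j ℕ.< m → side (z (m ℕ.+ j)) ≡ - 1ℚ
      side-second {j} j<m = trans (side-z (m ℕ.+ j)) (trans
        (cong (antipodal m (λ _ → 1ℚ)) (m<n⇒m%n≡m (ℕ.+-monoʳ-< m j<m)))
        (antipodal-+ m (λ _ → 1ℚ) j))

      0<m : 0 ℕ.< m
      0<m = ℕ.>-nonZero⁻¹ m

      side-middle : side (z m) ≡ - 1ℚ
      side-middle = trans (cong (side ∘ z) (sym (ℕ.+-identityʳ m))) (side-second 0<m)

      side-last : side (z (m ℕ.+ m)) ≡ 1ℚ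
      side-last = trans (side-z n) (trans (cong (antipodal m (λ _ → 1ℚ)) (n%n≡0 n)) (antipodal-< (λ _ → 1ℚ) 0<m))

    -- Cities are numbered cluster by cluster, so the identity crosses only from m - 1 to m and from
    -- n - 1 back to 0.
    shortTour : tourLength dist Perm.id ≡ 1ℚ + 1ℚ
    shortTour = begin
      tourLength dist Perm.id
        ≡⟨ tourLength≡pathLength dist Perm.id ⟩
      pathLength dist z (m ℕ.+ m)
        ≡⟨ pathLength-+ dist z m m ⟩
      pathLength dist z m + pathLength dist (z ∘ (m ℕ.+_)) m
        ≡⟨ cong₂ _+_
             (pathLength-straight dist z m (λ j → dist-refl (z j))
               (λ j<m w → cong (λ x → cut x (side w)) (trans (side-first j<m) (sym (side-first 0<m)))))
             (pathLength-straight dist (z ∘ (m ℕ.+_)) m (λ j → dist-refl (z (m ℕ.+ j)))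
               (λ j<m w → cong (λ x → cut x (side w)) (trans (side-second j<m) (sym (side-second 0<m))))) ⟩
      dist (z 0) (z m) + dist (z (m ℕ.+ 0)) (z (m ℕ.+ m))
        ≡⟨ cong₂ _+_ (cong₂ cut (side-first 0<m) side-middle) (cong₂ cut (side-second 0<m) side-last) ⟩
      1ℚ + 1ℚ ∎
      where open ≡-Reasoning

    tour-bound : ∀ σ → 1ℚ + 1ℚ ≤ tourLength dist σ
    tour-bound σ = subst (λ e → e + e ≤ tourLength dist σ) (cong₂ cut (side-first 0<m) side-middle)
      (tourLength-bound dist dist-refl dist-sym dist-triangle σ (z 0) (z m))

    dist-crisp : ∀ i j → Overlap.E cities i j * (1ℚ - Overlap.E cities i j) ≡ 0ℚ
    dist-crisp i j = cut-crisp (side-sign i) (side-sign j)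

  -- The value of the relaxation

  adjacent : ∀ n .{{_ : ℕ.NonZero n}} → Mat n
  adjacent n k l = if does (next k ≟ l) ∨ does (next l ≟ k) then 1ℚ else 0ℚ

  ∑-remainder : ∀ m {n} (f : Fin n → ℚ) → (∑ λ p → f (remainder {m} n p)) ≡ ones m * ∑ f
  ∑-remainder m {n} f = begin
    (∑ λ p → f (remainder {m} n p))
      ≡⟨ ∑-combine m {n} (λ p → f (remainder {m} n p)) ⟩
    ∑ {m} (λ i → ∑ λ k → f (remainder {m} n (combine i k)))
      ≡⟨ ∑²-cong {m} {n} (λ i k → cong (f ∘ proj₂) (remQuot-combine i k)) ⟩
    ∑ {m} (λ _ → ∑ f)
      ≡⟨ ∑-const m (∑ f) ⟩
    ones m * ∑ f ∎
    where open ≡-Reasoning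

  module Objective {n : ℕ} {c g h : ℚ} .{{_ : ℕ.NonZero n}} (size : ones n ≡ c + c)
    (ch≡1 : c * h ≡ 1ℚ) (cg≡1+g : c * g ≡ 1ℚ + g) (0≤g : 0ℚ ≤ g) (0≤h : 0ℚ ≤ h)
    (cities positions : Overlap n c) where

    open Overlap cities
    open Overlap positions using () renaming (E to Q; E-sym to Q-sym; E≤1 to Q≤1)
    open Relaxation size ch≡1 cg≡1+g 0≤g 0≤h cities positions

    module _ (crisp : ∀ i j → E i j * (1ℚ - E i j) ≡ 0ℚ) {η} (smooth : ∀ k → 1ℚ - Q k (next k) ≤ η) where

      private
        κ : ℚ
        κ = ½ * h * h * η

        -- An upper bound for `adjacent` without the disjunction: each of its two terms sums to n
        -- over all pairs.
        degree : Mat n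
        degree k l = δ (next k) l + δ (next l) k

        0≤½hh : 0ℚ ≤ ½ * h * h
        0≤½hh = *-nonneg (*-nonneg (ℚ.nonNegative⁻¹ ½) 0≤h) 0≤h

        entry-adjacent : ∀ i k j l → (1ℚ - E i j) * adjacent n k l * entry j l i k ≤ κ * degree k l
        entry-adjacent i k j l = subst (_≤ κ * degree k l) eq bound
          where
          x : ℚ
          x = (1ℚ - E i j) * entry i k j l
          eq : x * adjacent n k l ≡ (1ℚ - E i j) * adjacent n k l * entry j l i k
          eq = trans (solve 3 (λ a b c → a :* b :* c := a :* c :* b) refl (1ℚ - E i j) (entry i k j l) (adjacent n k l))
            (cong ((1ℚ - E i j) * adjacent n k l *_) (entry-sym i k j l))
          x≤κ : 1ℚ - Q k l ≤ η → x ≤ κ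
          x≤κ p = ℚ.≤-trans (entry-cut crisp i k j l)
            (ℚ.*-monoˡ-≤-nonNeg (½ * h * h) {{nonNegative 0≤½hh}} p)
          0≤η : 0ℚ ≤ η
          0≤η = ℚ.≤-trans (p≤q⇒0≤q-p (Q≤1 k (next k))) (smooth k)
          κ≤ : ∀ {e} → 0ℚ ≤ e → κ ≤ κ * (1ℚ + e)
          κ≤ {e} 0≤e = 0≤q-p⇒p≤q (subst (0ℚ ≤_)
            (solve 2 (λ κ e → κ :* e := κ :* (con 1ℚ :+ e) :- κ) refl κ e)
            (*-nonneg (*-nonneg 0≤½hh 0≤η) 0≤e))
          bound : x * adjacent n k l ≤ κ * degree k l
          bound with next k ≟ l | next l ≟ k
          ... | yes refl | l~k = ℚ.≤-trans (ℚ.≤-reflexive (ℚ.*-identityʳ x))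
                (ℚ.≤-trans (x≤κ (smooth k)) (κ≤ (sign l~k)))
            where
            sign : ∀ b → 0ℚ ≤ (if does b then 1ℚ else 0ℚ)
            sign (yes _) = ℚ.≤ᵇ⇒≤ tt
            sign (no _)  = ℚ.≤-refl
          ... | no _ | yes refl = ℚ.≤-trans (ℚ.≤-reflexive (ℚ.*-identityʳ x))
                (ℚ.≤-trans (x≤κ (subst (λ q → 1ℚ - q ≤ η) (Q-sym l (next l)) (smooth l))) (κ≤ {0ℚ} ℚ.≤-refl))
          ... | no _ | no _ = ℚ.≤-reflexive (trans (ℚ.*-zeroʳ x) (sym (ℚ.*-zeroʳ κ)))

        ∑-degree : ∑ (λ k → ∑ (degree k)) ≡ ones n + ones n
        ∑-degree = trans (∑²-distrib-+ (λ k l → δ (next k) l) (λ k l → δ (next l) k))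
          (cong₂ _+_ (sum-cong-≗ λ k → ∑-δ₁ (next k))
            (trans (∑-comm (λ k l → δ (next l) k)) (sum-cong-≗ λ l → ∑-δ₁ (next l))))

        qt rm : Fin (n ℕ.* n) → Fin n
        qt = quotient {n} n
        rm = remainder {n} n

      objectiveℚ : ℚ
      objectiveℚ = ½ * ∑ λ p → ∑ λ q → (1ℚ - E (qt p) (qt q)) * adjacent n (rm p) (rm q) * entry (qt q) (rm q) (qt p) (rm p)

      -- There are n² pairs of cities and a total degree of 2n, each unit bounded by `κ`, with n =
      -- 2c and c h = 1. Counting also the pairs inside a cluster, which contribute 0, loses only a
      -- factor 2.
      objective-bound : objectiveℚ ≤ (c + c + c + c) * η
      objective-bound = begin
        objectiveℚ
          ≤⟨ ℚ.*-monoˡ-≤-nonNeg ½ (∑-mono λ p → ∑-mono λ q → entry-adjacent (qt p) (rm p) (qt q) (rm q)) ⟩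
        ½ * (∑ λ p → ∑ λ q → κ * degree (rm p) (rm q))
          ≡⟨ cong (½ *_) (*-distribˡ-∑² κ (λ p q → degree (rm p) (rm q))) ⟨
        ½ * (κ * (∑ λ p → ∑ λ q → degree (rm p) (rm q)))
          ≡⟨ cong (λ e → ½ * (κ * e)) (trans (sum-cong-≗ λ p → ∑-remainder n (degree (rm p)))
               (trans (∑-remainder n (λ k → ones n * ∑ (degree k)))
                 (cong (ones n *_) (sym (*-distribˡ-sum (ones n) (λ k → ∑ (degree k))))))) ⟩
        ½ * (κ * (ones n * (ones n * ∑ (λ k → ∑ (degree k)))))
          ≡⟨ cong (λ e → ½ * (κ * (ones n * (ones n * e)))) ∑-degree ⟩
        ½ * (κ * (ones n * (ones n * (ones n + ones n))))
          ≡⟨ cong (λ e → ½ * (κ * (e * (e * (e + e))))) size ⟩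
        ½ * (½ * h * h * η * ((c + c) * ((c + c) * (c + c + (c + c)))))
          ≡⟨ solve 3 (λ c h η → con ½ :* (con ½ :* h :* h :* η :* ((c :+ c) :* ((c :+ c) :* (c :+ c :+ (c :+ c))))) :=
               (c :+ c :+ c :+ c) :* η :* (c :* h :* (c :* h))) refl c h η ⟩
        (c + c + c + c) * η * (c * h * (c * h))
          ≡⟨ trans (cong (λ e → (c + c + c + c) * η * (e * e)) ch≡1) (ℚ.*-identityʳ ((c + c + c + c) * η)) ⟩
        (c + c + c + c) * η ∎
        where open ℚ.≤-Reasoning

open import Data.Integer.Base as ℤ using (+_; -[1+_])
import Data.Integer.Properties as ℤ
open import Defs

-- Real numbers

ones≡/1 : ∀ n → ones n ≡ + n ℚ./ 1
ones≡/1 zero    = refl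
ones≡/1 (suc n) = trans (cong (1ℚ ℚ.+_) (trans (ones≡/1 n) (integral n)))
  (cong (λ a → (+ 1 ℤ.+ a) ℚ./ 1) (ℤ.*-identityʳ (+ n)))
  where
  integral : ∀ n → + n ℚ./ 1 ≡ ℚ.mkℚ (+ n) 0 (coprime-sym (1-coprimeTo n))
  integral n = ℚ.↥p/↧p≡p (ℚ.mkℚ (+ n) 0 (coprime-sym (1-coprimeTo n)))

ones-inverse : ∀ n .{{_ : ℕ.NonZero n}} → ones n ℚ.* (+ 1 ℚ./ n) ≡ 1ℚ
ones-inverse (suc k) = trans (cong (ℚ._* (+ 1 ℚ./ suc k)) (ones≡/1 (suc k))) (ℚ.toℚᵘ-injective (begin-equality
  ℚ.toℚᵘ ((+ suc k ℚ./ 1) ℚ.* (+ 1 ℚ./ suc k))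
    ≃⟨ ℚ.toℚᵘ-homo-* (+ suc k ℚ./ 1) (+ 1 ℚ./ suc k) ⟩
  ℚ.toℚᵘ (+ suc k ℚ./ 1) ℚᵘ.* ℚ.toℚᵘ (+ 1 ℚ./ suc k)
    ≃⟨ ℚᵘ.*-cong (ℚ.toℚᵘ-fromℚᵘ (ℚᵘ.mkℚᵘ (+ suc k) 0)) (ℚ.toℚᵘ-fromℚᵘ (ℚᵘ.mkℚᵘ (+ 1) k)) ⟩
  ℚᵘ.mkℚᵘ (+ suc k) 0 ℚᵘ.* ℚᵘ.mkℚᵘ (+ 1) k
    ≃⟨ ℚᵘ.*≡* (trans (ℤ.*-identityʳ _) (trans (ℤ.*-comm (+ suc k) (+ 1))
         (cong (λ e → + 1 ℤ.* + e) (sym (ℕ.*-identityˡ (suc k)))))) ⟩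
  ℚ.toℚᵘ 1ℚ ∎))
  where
  open ℚᵘ.≤-Reasoning

0≤1/n : ∀ n .{{_ : ℕ.NonZero n}} → 0ℚ ℚ.≤ + 1 ℚ./ n
0≤1/n n = ℚ.nonNegative⁻¹ (+ 1 ℚ./ n) {{ℚ.normalize-nonNeg 1 n}}

0<1/n : ∀ n .{{_ : ℕ.NonZero n}} → 0ℚ ℚ.< + 1 ℚ./ n
0<1/n n = ℚ.positive⁻¹ (+ 1 ℚ./ n) {{ℚ.normalize-pos 1 n}}

-- The Archimedean property: the denominator is at least 1.
p≤ones∣↥p∣ : ∀ p → p ℚ.≤ ones ℤ.∣ ℚ.↥ p ∣
p≤ones∣↥p∣ p = subst (p ℚ.≤_) (sym (ones≡/1 ℤ.∣ ℚ.↥ p ∣)) (ℚ.toℚᵘ-cancel-≤ (begin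
  ℚ.toℚᵘ p                        ≤⟨ numerator-bound p ⟩
  ℚᵘ.mkℚᵘ (+ ℤ.∣ ℚ.↥ p ∣) 0       ≃⟨ ℚ.toℚᵘ-fromℚᵘ (ℚᵘ.mkℚᵘ (+ ℤ.∣ ℚ.↥ p ∣) 0) ⟨
  ℚ.toℚᵘ (+ ℤ.∣ ℚ.↥ p ∣ ℚ./ 1)    ∎))
  where
  open ℚᵘ.≤-Reasoning
  numerator-bound : ∀ p → ℚ.toℚᵘ p ℚᵘ.≤ ℚᵘ.mkℚᵘ (+ ℤ.∣ ℚ.↥ p ∣) 0
  numerator-bound (ℚ.mkℚ (+ a) d _)     = ℚᵘ.*≤* (ℤ.*-monoˡ-≤-nonNeg (+ a) (ℤ.+≤+ (ℕ.s≤s ℕ.z≤n)))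
  numerator-bound (ℚ.mkℚ -[1+ a ] d _)  = ℚᵘ.*≤* (ℤ.≤-trans (ℤ.≤-reflexive (ℤ.*-identityʳ -[1+ a ])) ℤ.-≤+)

if-seq : ∀ b N → seq (if b then 1ℝ else 0ℝ) N ≡ (if b then 1ℚ else 0ℚ)
if-seq true  N = refl
if-seq false N = refl

sum-seq : ∀ {n} (f : Fin n → ℝ) N → seq (sum f) N ≡ ∑ λ i → seq (f i) N
sum-seq {zero}  f N = refl
sum-seq {suc n} f N = cong (seq (f zero) N ℚ.+_) (sum-seq (f ∘ suc) N)

sum²-seq : ∀ {m n} (f : Fin m → Fin n → ℝ) N →
  seq (sum λ i → sum λ j → f i j) N ≡ ∑ λ i → ∑ λ j → seq (f i j) N
sum²-seq f N = trans (sum-seq (λ i → sum (f i)) N) (sum-cong-≗ λ i → sum-seq (f i) N)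

pointwise-≈ : ∀ {x y} → (∀ N → seq x N ≡ seq y N) → x ≈ y
pointwise-≈ {x} {y} x≡y = mk≈ λ ε 0<ε → 0 , λ {N} _ →
  subst (ℚ._< ε) (sym (cong ℚ.∣_∣ (trans (cong (ℚ._- seq y N) (x≡y N)) (ℚ.+-inverseʳ (seq y N))))) 0<ε

pointwise-≤ : ∀ {x y} → (∀ N → seq x N ℚ.≤ seq y N) → x ≤ y
pointwise-≤ {x} {y} x≤y = mk≤ λ ε 0<ε → 0 , λ {N} _ →
  subst (ℚ._< seq y N ℚ.+ ε) (ℚ.+-identityʳ (seq x N)) (ℚ.+-mono-≤-< (x≤y N) 0<ε)

0<½ε : ∀ {ε} → 0ℚ ℚ.< ε → 0ℚ ℚ.< ½ ℚ.* ε
0<½ε {ε} 0<ε = subst (ℚ._< ½ ℚ.* ε) (ℚ.*-zeroʳ ½) (ℚ.*-monoʳ-<-pos ½ 0<ε)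

nonneg-+ : ∀ {x y} → 0ℝ ≤ x → 0ℝ ≤ y → 0ℝ ≤ x + y
nonneg-+ {x} {y} (mk≤ p) (mk≤ q) = mk≤ λ ε 0<ε →
  let N , a = p (½ ℚ.* ε) (0<½ε 0<ε)
      K , b = q (½ ℚ.* ε) (0<½ε 0<ε)
  in N ℕ.⊔ K , λ {n} N⊔K≤n → subst (0ℚ ℚ.<_)
       (solve 3 (λ x y e → x :+ con ½ :* e :+ (y :+ con ½ :* e) := x :+ y :+ e) refl (seq x n) (seq y n) ε)
       (ℚ.+-mono-< (a (ℕ.m⊔n≤o⇒m≤o N K N⊔K≤n)) (b (ℕ.m⊔n≤o⇒n≤o N K N⊔K≤n)))
  where open +-*-Solver

p≤∣p∣ : ∀ p → p ℚ.≤ ℚ.∣ p ∣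
p≤∣p∣ p with ℚ.≤-total 0ℚ p
... | inj₁ 0≤p = ℚ.≤-reflexive (sym (ℚ.0≤p⇒∣p∣≡p 0≤p))
... | inj₂ p≤0 = ℚ.≤-trans p≤0 (ℚ.0≤∣p∣ p)

≤-respʳ-≈ : ∀ {x y z} → z ≈ y → x ≤ y → x ≤ z
≤-respʳ-≈ {x} {y} {z} (mk≈ p) (mk≤ q) = mk≤ λ ε 0<ε →
  let N , a = p (½ ℚ.* ε) (0<½ε 0<ε)
      K , b = q (½ ℚ.* ε) (0<½ε 0<ε)
  in N ℕ.⊔ K , λ {n} N⊔K≤n → begin-strict
    seq x n
      <⟨ b (ℕ.m⊔n≤o⇒n≤o N K N⊔K≤n) ⟩
    seq y n ℚ.+ ½ ℚ.* ε
      ≡⟨ solve 3 (λ z y e → y :+ e := z :+ (:- (z :- y) :+ e)) refl (seq z n) (seq y n) (½ ℚ.* ε) ⟩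
    seq z n ℚ.+ (ℚ.- (seq z n ℚ.- seq y n) ℚ.+ ½ ℚ.* ε)
      ≤⟨ ℚ.+-monoʳ-≤ (seq z n) (ℚ.+-monoˡ-≤ (½ ℚ.* ε) (ℚ.≤-trans (p≤∣p∣ (ℚ.- (seq z n ℚ.- seq y n)))
           (ℚ.≤-trans (ℚ.≤-reflexive (ℚ.∣-p∣≡∣p∣ (seq z n ℚ.- seq y n))) (ℚ.<⇒≤ (a (ℕ.m⊔n≤o⇒m≤o N K N⊔K≤n)))))) ⟩
    seq z n ℚ.+ (½ ℚ.* ε ℚ.+ ½ ℚ.* ε)
      ≡⟨ solve 2 (λ z e → z :+ (con ½ :* e :+ con ½ :* e) := z :+ e) refl (seq z n) ε ⟩
    seq z n ℚ.+ ε ∎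
  where
  open ℚ.≤-Reasoning
  open +-*-Solver

nonneg-sum : ∀ {n} {f : Fin n → ℝ} → (∀ i → 0ℝ ≤ f i) → 0ℝ ≤ sum f
nonneg-sum {zero}  0≤f = pointwise-≤ λ _ → ℚ.≤-refl
nonneg-sum {suc n} 0≤f = nonneg-+ (0≤f zero) (nonneg-sum (0≤f ∘ suc))

Unital : ℚ → Set
Unital q = 0ℚ ℚ.≤ q × q ℚ.≤ 1ℚ

unital-* : ∀ {p q} → Unital p → Unital q → Unital (p ℚ.* q)
unital-* {p} {q} (0≤p , p≤1) (0≤q , q≤1) = *-nonneg 0≤p 0≤q ,
  ℚ.≤-trans (ℚ.*-monoˡ-≤-nonNeg p {{ℚ.nonNegative 0≤p}} q≤1) (ℚ.≤-trans (ℚ.≤-reflexive (ℚ.*-identityʳ p)) p≤1)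

unital-if : ∀ b → Unital (if b then 1ℚ else 0ℚ)
unital-if true  = ℚ.≤ᵇ⇒≤ tt , ℚ.≤-refl
unital-if false = ℚ.≤-refl , ℚ.≤ᵇ⇒≤ tt

-- With factors in [0, 1] no bound on the terms of y is needed.
nonneg-unital* : ∀ {x y} → (∀ N → Unital (seq x N)) → 0ℝ ≤ y → 0ℝ ≤ x * y
nonneg-unital* {x} {y} unital (mk≤ p) = mk≤ λ ε 0<ε →
  let N , a = p ε 0<ε
  in N , λ {n} N≤n → shrink 0<ε (unital n) (a N≤n)
  where
  shrink : ∀ {q r ε} → 0ℚ ℚ.< ε → Unital q → 0ℚ ℚ.< r ℚ.+ ε → 0ℚ ℚ.< q ℚ.* r ℚ.+ ε
  shrink {q} {r} {ε} 0<ε (0≤q , q≤1) 0<r+ε with ℚ.≤-total 0ℚ r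
  ... | inj₁ 0≤r = ℚ.+-mono-≤-< (*-nonneg 0≤q 0≤r) 0<ε
  ... | inj₂ r≤0 = ℚ.<-≤-trans 0<r+ε (ℚ.+-monoˡ-≤ ε
          (subst (ℚ._≤ q ℚ.* r) (ℚ.*-identityˡ r) (ℚ.*-monoʳ-≤-nonPos r {{ℚ.nonPositive r≤0}} q≤1)))

eventually-bounded : ∀ x → ∃ λ K → ∃ λ N → ∀ {n} → N ℕ.≤ n → ℚ.∣ seq x n ∣ ℚ.≤ ones K
eventually-bounded x =
  let N , p = cauchy x 1ℚ (ℚ.positive⁻¹ 1ℚ)
      B     = 1ℚ ℚ.+ ℚ.∣ seq x N ∣
  in ℤ.∣ ℚ.↥ B ∣ , N , λ {n} N≤n → begin
    ℚ.∣ seq x n ∣                                       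
      ≡⟨ cong ℚ.∣_∣ (solve 2 (λ a b → a := a :- b :+ b) refl (seq x n) (seq x N)) ⟩
    ℚ.∣ (seq x n ℚ.- seq x N) ℚ.+ seq x N ∣             ≤⟨ ℚ.∣p+q∣≤∣p∣+∣q∣ (seq x n ℚ.- seq x N) (seq x N) ⟩
    ℚ.∣ seq x n ℚ.- seq x N ∣ ℚ.+ ℚ.∣ seq x N ∣         ≤⟨ ℚ.+-monoˡ-≤ ℚ.∣ seq x N ∣ (ℚ.<⇒≤ (p N≤n ℕ.≤-refl)) ⟩
    B                                                   ≤⟨ p≤ones∣↥p∣ B ⟩
    ones ℤ.∣ ℚ.↥ B ∣                                    ∎
  where
  open ℚ.≤-Reasoning
  open +-*-Solver

-- Here Y is an arbitrary real matrix whose terms may be slightly negative, so a termwise check is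
-- impossible. The factors coming from D and C₁ lie termwise in [0, 1], which keeps those errors
-- from growing.
nonneg-objective : ∀ {n} .{{_ : ℕ.NonZero n}} {D : Matrix n n} {Y} →
  (∀ i j N → Unital (seq (D i j) N)) → NonNegative Y → 0ℝ ≤ objective D Y
nonneg-objective {n} {D} {Y} unital 0≤Y =
  nonneg-unital* (λ _ → ℚ.≤ᵇ⇒≤ tt , ℚ.≤ᵇ⇒≤ tt) (nonneg-sum λ p → nonneg-sum λ q →
    nonneg-unital* (λ N → unital-* (unital (quotient {n} n p) (quotient {n} n q) N)
      (C₁-unital (remainder {n} n p) (remainder {n} n q) N))
    (0≤Y q p))
  where
  C₁-unital : ∀ k l N → Unital (seq (C₁ n k l) N)
  C₁-unital k l N = subst Unital (sym (if-seq (does (next k ≟ l) ∨ does (next l ≟ k)) N))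
    (unital-if (does (next k ≟ l) ∨ does (next l ≟ k)))

-- M may have either sign and terms of s may be slightly negative, so |M s| is estimated: eventually
-- |s| is at most w + ε, hence |M s| is at most 1, which leaves a gap of ½ below 2.
small-product : ∀ {M s v : ℝ} {K : ℕ} {w ε : ℚ} → 0ℚ ℚ.≤ w → 0ℚ ℚ.< ε → 0ℝ ≤ s → s ≤ v → (∀ N → seq v N ℚ.≤ w) →
  (∃ λ N → ∀ {n} → N ℕ.≤ n → ℚ.∣ seq M n ∣ ℚ.≤ ones K) → ones K ℚ.* (w ℚ.+ ε) ℚ.≤ 1ℚ →
  M * s < fromℚ (1ℚ ℚ.+ 1ℚ)
small-product {M} {s} {v} {K} {w} {ε} 0≤w 0<ε (mk≤ lower) (mk≤ upper) v≤w (N₁ , M-bound) small =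
  let N₂ , s-lower = lower ε 0<ε
      N₃ , s-upper = upper ε 0<ε
      A = N₁ ℕ.⊔ N₂
  in mk< ½ (ℚ.positive⁻¹ ½) (A ℕ.⊔ N₃) λ {n} N≤n →
    let A≤n = ℕ.m⊔n≤o⇒m≤o A N₃ N≤n
    in bound (M-bound (ℕ.m⊔n≤o⇒m≤o N₁ N₂ A≤n)) (s-lower (ℕ.m⊔n≤o⇒n≤o N₁ N₂ A≤n))
             (ℚ.<-≤-trans (s-upper (ℕ.m⊔n≤o⇒n≤o A N₃ N≤n)) (ℚ.+-monoˡ-≤ ε (v≤w n)))
  where
  abs-bound : ∀ {x} → 0ℚ ℚ.< x ℚ.+ ε → x ℚ.< w ℚ.+ ε → ℚ.∣ x ∣ ℚ.≤ w ℚ.+ ε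
  abs-bound {x} 0<x+ε x<w+ε with ℚ.∣p∣≡p∨∣p∣≡-p x
  ... | inj₁ ∣x∣≡x  = ℚ.≤-trans (ℚ.≤-reflexive ∣x∣≡x) (ℚ.<⇒≤ x<w+ε)
  ... | inj₂ ∣x∣≡-x = ℚ.≤-trans (ℚ.≤-reflexive ∣x∣≡-x) (ℚ.≤-trans -x≤ε
          (subst (ℚ._≤ w ℚ.+ ε) (ℚ.+-identityˡ ε) (ℚ.+-monoˡ-≤ ε 0≤w)))
    where
    open +-*-Solver
    -x≤ε : ℚ.- x ℚ.≤ ε
    -x≤ε = 0≤q-p⇒p≤q (subst (0ℚ ℚ.≤_) (solve 2 (λ x e → x :+ e := e :- (:- x)) refl x ε) (ℚ.<⇒≤ 0<x+ε))
  bound : ∀ {a x} → ℚ.∣ a ∣ ℚ.≤ ones K → 0ℚ ℚ.< x ℚ.+ ε → x ℚ.< w ℚ.+ ε → a ℚ.* x ℚ.+ ½ ℚ.< 1ℚ ℚ.+ 1ℚ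
  bound {a} {x} ∣a∣≤K 0<x+ε x<w+ε = ℚ.+-mono-≤-< (begin
    a ℚ.* x                 ≤⟨ p≤∣p∣ (a ℚ.* x) ⟩
    ℚ.∣ a ℚ.* x ∣           ≡⟨ ℚ.∣p*q∣≡∣p∣*∣q∣ a x ⟩
    ℚ.∣ a ∣ ℚ.* ℚ.∣ x ∣     ≤⟨ ℚ.*-monoʳ-≤-nonNeg ℚ.∣ x ∣ {{ℚ.∣-∣-nonNeg x}} ∣a∣≤K ⟩
    ones K ℚ.* ℚ.∣ x ∣      ≤⟨ ℚ.*-monoˡ-≤-nonNeg (ones K) {{ℚ.nonNegative 0≤K}} (abs-bound 0<x+ε x<w+ε) ⟩
    ones K ℚ.* (w ℚ.+ ε)    ≤⟨ small ⟩
    1ℚ                      ∎) (from-yes (½ ℚ.<? 1ℚ))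
    where
    open ℚ.≤-Reasoning
    0≤K : 0ℚ ℚ.≤ ones K
    0≤K = ℚ.≤-trans (ℚ.0≤∣p∣ a) ∣a∣≤K

-- Feasibility

δ-seq : ∀ {n} (i j : Fin n) N → seq (I n i j) N ≡ δ i j
δ-seq i j N = if-seq (does (i ≟ j)) N

module _ {n : ℕ} (N : ℕ) where
  private
    qt rm : Fin (n ℕ.* n) → Fin n
    qt = quotient {n} n
    rm = remainder {n} n
    rows : Fin (1 ℕ.* n ℕ.+ n ℕ.* 1) → Fin (n ℕ.* n) → ℚ
    rows r p = seq (F n r p) N

  open +-*-Solver
  open ≡-Reasoning

  F-upper : ∀ a p → rows (combine {1} {n} zero a ↑ˡ (n ℕ.* 1)) p ≡ δ a (rm p)
  F-upper a p = begin
    rows (combine {1} {n} zero a ↑ˡ (n ℕ.* 1)) p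
      ≡⟨ cong (λ s → seq ([ onesRow n ⊗ I n , I n ⊗ onesRow n ]′ s p) N)
         (splitAt-↑ˡ (1 ℕ.* n) (combine {1} {n} zero a) (n ℕ.* 1)) ⟩
    1ℚ ℚ.* seq (I n (remainder {1} n (combine {1} {n} zero a)) (rm p)) N
      ≡⟨ ℚ.*-identityˡ _ ⟩
    seq (I n (remainder {1} n (combine {1} {n} zero a)) (rm p)) N
      ≡⟨ cong (λ x → seq (I n (proj₂ x) (rm p)) N) (remQuot-combine {1} {n} zero a) ⟩
    seq (I n a (rm p)) N
      ≡⟨ δ-seq a (rm p) N ⟩
    δ a (rm p) ∎

  F-lower : ∀ a p → rows ((1 ℕ.* n) ↑ʳ combine {n} {1} a zero) p ≡ δ a (qt p)
  F-lower a p = begin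
    rows ((1 ℕ.* n) ↑ʳ combine {n} {1} a zero) p
      ≡⟨ cong (λ s → seq ([ onesRow n ⊗ I n , I n ⊗ onesRow n ]′ s p) N)
         (splitAt-↑ʳ (1 ℕ.* n) (n ℕ.* 1) (combine {n} {1} a zero)) ⟩
    seq (I n (quotient {n} 1 (combine {n} {1} a zero)) (qt p)) N ℚ.* 1ℚ
      ≡⟨ ℚ.*-identityʳ _ ⟩
    seq (I n (quotient {n} 1 (combine {n} {1} a zero)) (qt p)) N
      ≡⟨ cong (λ x → seq (I n (proj₁ x) (qt p)) N) (remQuot-combine {n} {1} a zero) ⟩
    seq (I n a (qt p)) N
      ≡⟨ δ-seq a (qt p) N ⟩
    δ a (qt p) ∎

  -- Upper rows of F compare remainders, lower rows quotients: F^T F = J ⊗ I + I ⊗ J.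
  FᵀF-seq : ∀ p q → seq ((F n ᵀ · F n) p q) N ≡ δ (rm p) (rm q) ℚ.+ δ (qt p) (qt q)
  FᵀF-seq p q = begin
    seq ((F n ᵀ · F n) p q) N
      ≡⟨ sum-seq (λ r → F n r p * F n r q) N ⟩
    ∑ f
      ≡⟨ ∑-↑ (1 ℕ.* n) {n ℕ.* 1} f ⟩
    ∑ (λ r → f (r ↑ˡ (n ℕ.* 1))) ℚ.+ ∑ (λ r → f ((1 ℕ.* n) ↑ʳ r))
      ≡⟨ cong₂ ℚ._+_ (∑-combine 1 {n} (λ r → f (r ↑ˡ (n ℕ.* 1)))) (∑-combine n {1} (λ r → f ((1 ℕ.* n) ↑ʳ r))) ⟩
    (∑ (λ a → f (combine {1} {n} zero a ↑ˡ (n ℕ.* 1))) ℚ.+ 0ℚ) ℚ.+ ∑ (λ a → f ((1 ℕ.* n) ↑ʳ combine {n} {1} a zero) ℚ.+ 0ℚ)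
      ≡⟨ cong₂ ℚ._+_
           (trans (ℚ.+-identityʳ _) (trans (sum-cong-≗ λ a → cong₂ ℚ._*_ (F-upper a p) (F-upper a q))
             (∑-δ (rm p) (λ a → δ a (rm q)))))
           (trans (sum-cong-≗ λ a → trans (ℚ.+-identityʳ _) (cong₂ ℚ._*_ (F-lower a p) (F-lower a q)))
             (∑-δ (qt p) (λ a → δ a (qt q)))) ⟩
    δ (rm p) (rm q) ℚ.+ δ (qt p) (qt q) ∎
    where
    f : Fin (1 ℕ.* n ℕ.+ n ℕ.* 1) → ℚ
    f r = rows r p ℚ.* rows r q

module Solution {n : ℕ} {c g h : ℚ} .{{_ : ℕ.NonZero n}} (size : ones n ≡ c ℚ.+ c)
  (ch≡1 : c ℚ.* h ≡ 1ℚ) (cg≡1+g : c ℚ.* g ≡ 1ℚ ℚ.+ g) (0≤g : 0ℚ ℚ.≤ g) (0≤h : 0ℚ ℚ.≤ h)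
  (cities positions : Overlap n c) where

  open Relaxation size ch≡1 cg≡1+g 0≤g 0≤h cities positions

  private
    qt rm : Fin (n ℕ.* n) → Fin n
    qt = quotient {n} n
    rm = remainder {n} n

  solution : Matrix (n ℕ.* n) (n ℕ.* n)
  solution p q = fromℚ (entry (qt p) (rm p) (qt q) (rm q))

  private
    block-seq : ∀ i j k l N → seq (block solution i j k l) N ≡ entry i k j l
    block-seq i j k l N = cong₂ (λ x y → entry (proj₁ x) (proj₂ x) (proj₁ y) (proj₂ y))
      (remQuot-combine i k) (remQuot-combine j l)

    weight : seq (1/n² n) 0 ≡ ½ ℚ.* h ℚ.* (½ ℚ.* h)
    weight = begin
      κ ≡⟨ ℚ.*-identityʳ κ ⟨
      κ ℚ.* (1ℚ ℚ.* 1ℚ)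
        ≡⟨ cong (λ e → κ ℚ.* (e ℚ.* e)) ch≡1 ⟨
      κ ℚ.* (c ℚ.* h ℚ.* (c ℚ.* h))
        ≡⟨ solve 3 (λ κ c h → κ :* (c :* h :* (c :* h)) :=
             (c :+ c) :* (c :+ c) :* κ :* (con ½ :* h :* (con ½ :* h))) refl κ c h ⟩
      (c ℚ.+ c) ℚ.* (c ℚ.+ c) ℚ.* κ ℚ.* (½ ℚ.* h ℚ.* (½ ℚ.* h))
        ≡⟨ cong (λ e → e ℚ.* κ ℚ.* (½ ℚ.* h ℚ.* (½ ℚ.* h)))
             (trans (ones-* n n) (cong₂ ℚ._*_ size size)) ⟨
      ones (n ℕ.* n) ℚ.* κ ℚ.* (½ ℚ.* h ℚ.* (½ ℚ.* h))
        ≡⟨ cong (ℚ._* (½ ℚ.* h ℚ.* (½ ℚ.* h))) (ones-inverse (n ℕ.* n) {{ℕ.m*n≢0 n n}}) ⟩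
      1ℚ ℚ.* (½ ℚ.* h ℚ.* (½ ℚ.* h))
        ≡⟨ ℚ.*-identityˡ _ ⟩
      ½ ℚ.* h ℚ.* (½ ℚ.* h) ∎
      where
      open ≡-Reasoning
      open +-*-Solver
      κ : ℚ
      κ = seq (1/n² n) 0

    -- The term with equal remainders collects the traces of all blocks, the term with equal
    -- quotients all entries of the diagonal blocks. By the two block conditions each is the sum of
    -- the entries of I, which is n.
    traces : ∑ (λ p → ∑ λ q → entry (qt p) (rm p) (qt q) (rm q) ℚ.* (δ (rm q) (rm p) ℚ.+ δ (qt q) (qt p))) 
      ≡ ones n ℚ.+ ones n
    traces = begin
      ∑ (λ p → ∑ λ q → entry (qt p) (rm p) (qt q) (rm q) ℚ.* (δ (rm q) (rm p) ℚ.+ δ (qt q) (qt p)))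
        ≡⟨ ∑²-cong (λ p q → solve 3 (λ y a b → y :* (a :+ b) := a :* y :+ b :* y) refl
             (entry (qt p) (rm p) (qt q) (rm q)) (δ (rm q) (rm p)) (δ (qt q) (qt p))) ⟩
      ∑ (λ p → ∑ λ q → δ (rm q) (rm p) ℚ.* e p q ℚ.+ δ (qt q) (qt p) ℚ.* e p q)
        ≡⟨ ∑²-distrib-+ (λ p q → δ (rm q) (rm p) ℚ.* e p q) (λ p q → δ (qt q) (qt p) ℚ.* e p q) ⟩
      ∑ (λ p → ∑ λ q → δ (rm q) (rm p) ℚ.* e p q) ℚ.+ ∑ (λ p → ∑ λ q → δ (qt q) (qt p) ℚ.* e p q)
        ≡⟨ cong₂ ℚ._+_ (trans (split (λ i k j l → δ l k ℚ.* entry i k j l)) offDiagonal)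
                        (trans (split (λ i k j l → δ j i ℚ.* entry i k j l)) onDiagonal) ⟩
      ones n ℚ.+ ones n ∎
      where
      open ≡-Reasoning
      open +-*-Solver
      e : Fin (n ℕ.* n) → Fin (n ℕ.* n) → ℚ
      e p q = entry (qt p) (rm p) (qt q) (rm q)
      split : ∀ (f : Fin n → Fin n → Fin n → Fin n → ℚ) →
        ∑ (λ p → ∑ λ q → f (qt p) (rm p) (qt q) (rm q)) ≡ ∑ λ i → ∑ λ k → ∑ λ j → ∑ λ l → f i k j l
      split f = trans (∑-combine n {n} (λ p → ∑ λ q → f (qt p) (rm p) (qt q) (rm q)))
        (∑²-cong λ i k → trans (∑-combine n {n} (λ q → f (qt (combine i k)) (rm (combine i k)) (qt q) (rm q)))
          (∑²-cong λ j l → cong₂ (λ x y → f (proj₁ x) (proj₂ x) (proj₁ y) (proj₂ y))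
            (remQuot-combine i k) (remQuot-combine j l)))
      ∑∑δ : (∑ λ i → ∑ (δ {n} i)) ≡ ones n
      ∑∑δ = sum-cong-≗ {n} ∑-δ₁
      offDiagonal : (∑ λ i → ∑ λ k → ∑ λ j → ∑ λ l → δ l k ℚ.* entry i k j l) ≡ ones n
      offDiagonal = begin
        (∑ λ i → ∑ λ k → ∑ λ j → ∑ λ l → δ l k ℚ.* entry i k j l)
          ≡⟨ ∑²-cong (λ i k → sum-cong-≗ λ j → ∑-δ k (λ l → entry i k j l)) ⟩
        (∑ λ i → ∑ λ k → ∑ λ j → entry i k j k)
          ≡⟨ sum-cong-≗ (λ i → ∑-comm (λ k j → entry i k j k)) ⟩
        (∑ λ i → ∑ λ j → ∑ λ k → entry i k j k)
          ≡⟨ ∑²-cong {n} {n} ∑-blockTrace ⟩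
        (∑ λ i → ∑ (δ {n} i))
          ≡⟨ ∑∑δ ⟩
        ones n ∎
      onDiagonal : (∑ λ i → ∑ λ k → ∑ λ j → ∑ λ l → δ j i ℚ.* entry i k j l) ≡ ones n
      onDiagonal = begin
        (∑ λ i → ∑ λ k → ∑ λ j → ∑ λ l → δ j i ℚ.* entry i k j l)
          ≡⟨ ∑²-cong (λ i k → trans (sum-cong-≗ λ j → sym (*-distribˡ-sum (δ j i) (λ l → entry i k j l)))
               (∑-δ i (λ j → ∑ λ l → entry i k j l))) ⟩
        (∑ λ i → ∑ λ k → ∑ λ l → entry i k i l)
          ≡⟨ ∑-comm (λ i k → ∑ λ l → entry i k i l) ⟩
        (∑ λ k → ∑ λ i → ∑ λ l → entry i k i l)
          ≡⟨ sum-cong-≗ (λ k → ∑-comm (λ i l → entry i k i l)) ⟩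
        (∑ λ k → ∑ λ l → ∑ λ i → entry i k i l)
          ≡⟨ ∑²-cong {n} {n} ∑-diagonalBlocks ⟩
        (∑ λ k → ∑ (δ {n} k))
          ≡⟨ ∑∑δ ⟩
        ones n ∎

  feasible : Feasible n solution
  feasible = record
    { symmetric      = λ p q → pointwise-≈ λ _ → entry-sym (qt q) (rm q) (qt p) (rm p)
    ; nonneg         = λ p q → pointwise-≤ λ _ → entry-nonneg (qt p) (rm p) (qt q) (rm q)
    ; diagonalBlocks = λ k l → pointwise-≈ λ N → begin
        seq (sum λ i → block solution i i k l) N  ≡⟨ sum-seq (λ i → block solution i i k l) N ⟩
        (∑ λ i → seq (block solution i i k l) N)  ≡⟨ sum-cong-≗ (λ i → block-seq i i k l N) ⟩
        (∑ λ i → entry i k i l)                   ≡⟨ ∑-diagonalBlocks k l ⟩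
        δ k l                                     ≡⟨ δ-seq k l N ⟨
        seq (I n k l) N                           ∎
    ; blockTraces    = λ i j → pointwise-≈ λ N → begin
        seq (trace (block solution i j)) N        ≡⟨ sum-seq (λ k → block solution i j k k) N ⟩
        (∑ λ k → seq (block solution i j k k) N)  ≡⟨ sum-cong-≗ (λ k → block-seq i j k k N) ⟩
        (∑ λ k → entry i k j k)                   ≡⟨ ∑-blockTrace i j ⟩
        δ i j                                     ≡⟨ δ-seq i j N ⟨
        seq (I n i j) N                           ∎
    ; traceYFᵀF      = pointwise-≈ λ N → begin
        seq (trace (solution · (F n ᵀ · F n))) N
          ≡⟨ sum²-seq (λ p q → solution p q * (F n ᵀ · F n) q p) N ⟩
        ∑ (λ p → ∑ λ q → entry (qt p) (rm p) (qt q) (rm q) ℚ.* seq ((F n ᵀ · F n) q p) N)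
          ≡⟨ ∑²-cong (λ p q → cong (entry (qt p) (rm p) (qt q) (rm q) ℚ.*_) (FᵀF-seq {n} N q p)) ⟩
        ∑ (λ p → ∑ λ q → entry (qt p) (rm p) (qt q) (rm q) ℚ.* (δ (rm q) (rm p) ℚ.+ δ (qt q) (qt p)))
          ≡⟨ traces ⟩
        ones n ℚ.+ ones n
          ≡⟨ cong (ones n ℚ.+_) (cong ones (ℕ.+-identityʳ n)) ⟨
        ones n ℚ.+ ones (n ℕ.+ 0)
          ≡⟨ ones-+ n (n ℕ.+ 0) ⟨
        ones (2 ℕ.* n)
          ≡⟨ ones≡/1 (2 ℕ.* n) ⟩
        + (2 ℕ.* n) ℚ./ 1 ∎
    ; psd            =
        (λ p q → pointwise-≈ λ N → cong (ℚ._- seq (1/n² n) N ℚ.* 1ℚ) (entry-sym (qt q) (rm q) (qt p) (rm p))) ,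
        λ x → pointwise-≤ λ N → subst (0ℚ ℚ.≤_)
          (trans
            (∑²-cong λ p q → cong (λ w → seq (x p) N ℚ.* (entry (qt p) (rm p) (qt q) (rm q) ℚ.- w) ℚ.* seq (x q) N)
              (trans (sym weight) (sym (ℚ.*-identityʳ (seq (1/n² n) N)))))
            (sym (sum²-seq (λ p q → x p * (solution -ᴹ 1/n² n • J (n ℕ.* n)) p q * x q) N)))
          (form-nonneg SOS-shifted (λ p → seq (x p) N))
    }
    where open ≡-Reasoning

-- The two-cluster instance and its gap.

module Instance {m : ℕ} {g h : ℚ} .{{_ : ℕ.NonZero m}} (2≤m : 2 ℕ.≤ m) (ch≡1 : ones m ℚ.* h ≡ 1ℚ)
  (cg≡1+g : ones m ℚ.* g ≡ 1ℚ ℚ.+ g) (0≤g : 0ℚ ℚ.≤ g) (0≤h : 0ℚ ℚ.≤ h) where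

  private
    n : ℕ
    n = m ℕ.+ m
    instance
      n≢0 : ℕ.NonZero n
      n≢0 = ℕ.>-nonZero (ℕ.≤-trans (ℕ.>-nonZero⁻¹ m) (ℕ.m≤m+n m m))
    c : ℚ
    c = ones m

  open Clusters m
  open Overlap cities using (0≤E; E≤1)
  open Solution (ones-+ m m) ch≡1 cg≡1+g 0≤g 0≤h cities (positions {m} ch≡1) public
  open Objective (ones-+ m m) ch≡1 cg≡1+g 0≤g 0≤h cities (positions {m} ch≡1)

  private
    dist-nonneg : ∀ i j → 0ℚ ℚ.≤ dist i j
    dist-nonneg i j = p≤q⇒0≤q-p (E≤1 i j)

    dist≤1 : ∀ i j → dist i j ℚ.≤ 1ℚ
    dist≤1 i j = 0≤q-p⇒p≤q (subst (0ℚ ℚ.≤_)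
      (solve 1 (λ e → e := con 1ℚ :- (con 1ℚ :- e)) refl (Overlap.E cities i j)) (0≤E i j))
      where open +-*-Solver

    smooth : ∀ i → 1ℚ ℚ.- Overlap.E (positions {m} ch≡1) i (next i) ℚ.≤ (h ℚ.+ h) ℚ.* (h ℚ.+ h)
    smooth i = subst (StepBound (toℕ i)) (sym (toℕ-fromℕ< (m%n<n (suc (toℕ i)) n))) (step-bound (toℕ<n i))
      where open Arc {m} ch≡1

  D : Matrix n n
  D i j = fromℚ (dist i j)

  𝓘 : TSPInstance
  𝓘 = record
    { n         = n
    ; 3≤n       = ℕ.≤-trans (ℕ.n≤1+n 3) (ℕ.+-mono-≤ 2≤m 2≤m)
    ; D         = D
    ; symmetric = λ i j → pointwise-≈ λ _ → dist-sym j i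
    ; nonneg    = λ i j → pointwise-≤ λ _ → dist-nonneg i j
    ; diagonal  = λ i → pointwise-≈ λ _ → dist-refl i
    ; triangle  = λ i j l → pointwise-≤ λ _ → dist-triangle i j l
    }

  optimalTour : IsOPT-TSP D (fromℚ (1ℚ ℚ.+ 1ℚ))
  optimalTour = (Perm.id , pointwise-≈ λ N → sym (trans (tourCost-seq Perm.id N) shortTour)) ,
    λ w (σ , w≈) → ≤-respʳ-≈ w≈ (pointwise-≤ λ N → subst (1ℚ ℚ.+ 1ℚ ℚ.≤_) (sym (tourCost-seq σ N)) (tour-bound σ))
    where
    tourCost-seq : ∀ σ N → seq (tourCost D σ) N ≡ tourLength dist σ
    tourCost-seq σ N = sum-seq (λ i → D (σ ⟨$⟩ʳ i) (σ ⟨$⟩ʳ next i)) N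

  sdpValue : SDPValue D (objective D solution)
  sdpValue = solution , feasible , pointwise-≈ λ _ → refl

  -- Each step of the parameter is 2h, so η = 4h², and 4c · 4h² = 16h by c h = 1.
  value-bound : ∀ N → seq (objective D solution) N ℚ.≤ (+ 16 ℚ./ 1) ℚ.* h
  value-bound N = begin
    seq (objective D solution) N
      ≡⟨ cong (½ ℚ.*_) (trans (sum²-seq (λ p q → (D ⊗ C₁ n) p q * solution q p) N)
           (∑²-cong λ p q → cong (λ e → dist (qt p) (qt q) ℚ.* e ℚ.* seq (solution q p) N)
             (if-seq (does (next (rm p) ≟ rm q) ∨ does (next (rm q) ≟ rm p)) N))) ⟩
    objectiveℚ dist-crisp smooth
      ≤⟨ objective-bound dist-crisp smooth ⟩
    (c ℚ.+ c ℚ.+ c ℚ.+ c) ℚ.* ((h ℚ.+ h) ℚ.* (h ℚ.+ h))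
      ≡⟨ solve 2 (λ c h → (c :+ c :+ c :+ c) :* ((h :+ h) :* (h :+ h)) := con (+ 16 ℚ./ 1) :* (c :* h) :* h) refl c h ⟩
    (+ 16 ℚ./ 1) ℚ.* (c ℚ.* h) ℚ.* h
      ≡⟨ cong (λ e → (+ 16 ℚ./ 1) ℚ.* e ℚ.* h) ch≡1 ⟩
    (+ 16 ℚ./ 1) ℚ.* h ∎
    where
    open ℚ.≤-Reasoning
    open +-*-Solver
    qt rm : Fin (n ℕ.* n) → Fin n
    qt = quotient {n} n
    rm = remainder {n} n

  value-nonneg : ∀ {v} → SDPValue D v → 0ℝ ≤ v
  value-nonneg (Y , Y-feasible , v≈) = ≤-respʳ-≈ v≈
    (nonneg-objective {D = D} {Y} (λ i j _ → dist-nonneg i j , dist≤1 i j) (Feasible.nonneg Y-feasible))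

  -- A least value s lies between 0 and the value of `solution`, whose terms are at most w = 16h.
  -- The tolerance ε = h is taken for the Cauchy sequences, so the quantity to be made small is K
  -- (16h + h); this is the source of the constant 17.
  gap : ∀ M K → (∃ λ N → ∀ {n} → N ℕ.≤ n → ℚ.∣ seq M n ∣ ℚ.≤ ones K) →
    0ℚ ℚ.< h → ones K ℚ.* ((+ 16 ℚ./ 1) ℚ.* h ℚ.+ h) ℚ.≤ 1ℚ →
    ∃ λ t → IsOPT-TSP D t × 0ℝ < t × ∃ (SDPValue D) × (∀ s → IsOPT-SDP D s → M * s < t)
  gap M K M-bound 0<h K-small =
    fromℚ (1ℚ ℚ.+ 1ℚ) , optimalTour ,
    mk< 1ℚ (ℚ.positive⁻¹ 1ℚ) 0 (λ _ → from-yes (0ℚ ℚ.+ 1ℚ ℚ.<? 1ℚ ℚ.+ 1ℚ)) ,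
    (objective D solution , sdpValue) ,
    λ s (s-value , s-least) → small-product {M} {s} {K = K} (*-nonneg {+ 16 ℚ./ 1} (ℚ.≤ᵇ⇒≤ tt) 0≤h) 0<h
      (value-nonneg s-value) (s-least (objective D solution) sdpValue) value-bound M-bound K-small

ones-scaled : ∀ K {m h} → 17 ℕ.* K ℕ.≤ m → 0ℚ ℚ.≤ h → ones m ℚ.* h ≡ 1ℚ →
  ones K ℚ.* ((+ 16 ℚ./ 1) ℚ.* h ℚ.+ h) ℚ.≤ 1ℚ
ones-scaled K {m} {h} 17K≤m 0≤h ch≡1 = begin
  ones K ℚ.* ((+ 16 ℚ./ 1) ℚ.* h ℚ.+ h)
    ≡⟨ solve 2 (λ x h → x :* (con (+ 16 ℚ./ 1) :* h :+ h) := con (+ 17 ℚ./ 1) :* x :* h) refl (ones K) h ⟩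
  (+ 17 ℚ./ 1) ℚ.* ones K ℚ.* h
    ≡⟨ cong (λ e → e ℚ.* ones K ℚ.* h) (ones≡/1 17) ⟨
  ones 17 ℚ.* ones K ℚ.* h
    ≡⟨ cong (ℚ._* h) (ones-* 17 K) ⟨
  ones (17 ℕ.* K) ℚ.* h
    ≤⟨ ℚ.*-monoʳ-≤-nonNeg h {{ℚ.nonNegative 0≤h}} (ones-mono 17K≤m) ⟩
  ones m ℚ.* h
    ≡⟨ ch≡1 ⟩
  1ℚ ∎
  where
  open ℚ.≤-Reasoning
  open +-*-Solver
  ones-mono : ∀ {a b} → a ℕ.≤ b → ones a ℚ.≤ ones b
  ones-mono {b = b} ℕ.z≤n = ∑-nonneg {b} {λ _ → 1ℚ} λ _ → ℚ.≤ᵇ⇒≤ tt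
  ones-mono (ℕ.s≤s a≤b) = ℚ.+-monoʳ-≤ 1ℚ (ones-mono a≤b)

corollary4p23 : ∀ (M : ℝ) → ∃ λ (𝓘 : TSPInstance) → let open TSPInstance 𝓘 in
    ∃ λ t → IsOPT-TSP D t × 0ℝ < t ×
    ∃ (SDPValue D) × (∀ s → IsOPT-SDP D s → M * s < t)
corollary4p23 M =
  let K , M-bound = eventually-bounded M
      -- The cluster size is m = k + 1 = 17K + 2: at least 17K for the estimate, and at least 2 so
      -- that g = 1/(m - 1) = 1/k exists and n ≥ 4.
      k = suc (17 ℕ.* K)
  in unbounded K M-bound (suc k) (ℕ.s≤s (ℕ.s≤s ℕ.z≤n)) (ℕ.m≤n+m (17 ℕ.* K) 2) (+ 1 ℚ./ k) (0≤1/n k) (cg≡1+g k)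
  where
  cg≡1+g : ∀ k .{{_ : ℕ.NonZero k}} → ones (suc k) ℚ.* (+ 1 ℚ./ k) ≡ 1ℚ ℚ.+ (+ 1 ℚ./ k)
  cg≡1+g k = trans (solve 2 (λ x g → (con 1ℚ :+ x) :* g := x :* g :+ g) refl (ones k) (+ 1 ℚ./ k))
    (cong (ℚ._+ (+ 1 ℚ./ k)) (ones-inverse k))
    where open +-*-Solver

  unbounded : ∀ K → (∃ λ N → ∀ {n} → N ℕ.≤ n → ℚ.∣ seq M n ∣ ℚ.≤ ones K) →
    ∀ m .{{_ : ℕ.NonZero m}} → 2 ℕ.≤ m → 17 ℕ.* K ℕ.≤ m →
    ∀ g → 0ℚ ℚ.≤ g → ones m ℚ.* g ≡ 1ℚ ℚ.+ g →
    ∃ λ (𝓘 : TSPInstance) → let open TSPInstance 𝓘 in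
      ∃ λ t → IsOPT-TSP D t × 0ℝ < t × ∃ (SDPValue D) × (∀ s → IsOPT-SDP D s → M * s < t)
  unbounded K M-bound m 2≤m 17K≤m g 0≤g cg≡1+g =
    𝓘 , gap M K M-bound (0<1/n m) (ones-scaled K 17K≤m (0≤1/n m) (ones-inverse m))
    where open Instance {m} 2≤m (ones-inverse m) cg≡1+g 0≤g (0≤1/n m)
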